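{- Let $n \geq 7$ and let $G$ be a $2$-geodetic digraph with order $n$ and maximal size (i.e. with $ex(n;2)$ arcs). Then $G$ is isomorphic to an orientation of $K_{\lceil \frac{n}{2} \rceil, \lfloor \frac{n}{2} \rfloor}$ in which all arcs are oriented in the same direction between the two partite sets, except for the arcs of a matching (possibly empty) that are oriented in the opposite direction. The number of isomorphism classes of such extremal digraphs is $n+1$ for odd $n \geq 7$ and $\frac{n}{2}+1$ for even $n \geq 8$.
   Context: A digraph has a vertex set and an arc set consisting of ordered pairs of distinct vertices. A walk of length $\ell$ is a sequence $x_0x_1\dots x_\ell$ of vertices with $x_i \rightarrow x_{i+1}$ for all $i$. A digraph is $k$-geodetic if for every ordered pair $(u,v)$ of (not necessarily distinct) vertices there is at most one $u,v$-walk of length at most $k$. For $n,k\ge 2$, $ex(n;k)$ is the largest possible number of arcs of a $k$-geodetic digraph on $n$ vertices. Order = number of vertices, size = number of arcs. -}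

module Defs where

open import Data.Nat using (ℕ; zero; suc; _+_; _≤_; ⌊_/2⌋; ⌈_/2⌉)
open import Data.Fin using (Fin)
open import Data.Fin.Permutation using (Permutation′; _⟨$⟩ʳ_)
open import Data.Bool using (Bool; true; false; if_then_else_; not)
open import Data.List using (List; []; _∷_; length; map; allFin)
open import Data.Nat.ListAction using (sum)
open import Data.List.Relation.Unary.All using (All)
open import Data.List.Relation.Unary.Any using (Any)
open import Data.List.Relation.Unary.AllPairs using (AllPairs)
open import Data.Product using (Σ; _×_; ∃)
open import Data.Sum using (_⊎_)
open import Relation.Binary.PropositionalEquality using (_≡_; _≢_)
open import Relation.Nullary using (¬_)

record Digraph (n : ℕ) : Set where
  field
    arc      : Fin n → Fin n → Bool
    loopless : ∀ v → arc v v ≡ false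
open Digraph public

count : {n : ℕ} → (Fin n → Bool) → ℕ
count {n} p = sum (map (λ v → if p v then 1 else 0) (allFin n))

size : {n : ℕ} → Digraph n → ℕ
size {n} G = sum (map (λ u → count (arc G u)) (allFin n))

-- IsWalk G u xs v : the sequence u x₁ … x_ℓ (xs = x₁ … x_ℓ) is a walk
-- from u to v (so x_ℓ = v, or u = v when ℓ = 0); its length is length xs.
IsWalk : {n : ℕ} → Digraph n → Fin n → List (Fin n) → Fin n → Set
IsWalk G u []       v = u ≡ v
IsWalk G u (x ∷ xs) v = (arc G u x ≡ true) × IsWalk G x xs v

Geodetic : {n : ℕ} → ℕ → Digraph n → Set
Geodetic {n} k G = ∀ (u v : Fin n) (xs ys : List (Fin n)) →
  length xs ≤ k → length ys ≤ k →
  IsWalk G u xs v → IsWalk G u ys v → xs ≡ ys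

Extremal2 : {n : ℕ} → Digraph n → Set
Extremal2 {n} G = Geodetic 2 G × (∀ (H : Digraph n) → Geodetic 2 H → size H ≤ size G)

_≅_ : {n : ℕ} → Digraph n → Digraph n → Set
_≅_ {n} G H = Σ (Permutation′ n) λ σ →
  ∀ (u v : Fin n) → arc G u v ≡ arc H (σ ⟨$⟩ʳ u) (σ ⟨$⟩ʳ v)

-- D is an orientation of K_{⌈n/2⌉,⌊n/2⌋} (partite sets X = {part ≡ true},
-- Y = {part ≡ false}) in which all arcs go from the partite set
-- {part ≡ dir} to the other one, except for the arcs of a matching
-- (possibly empty), which are oriented in the opposite direction.
record MatchingReversedBipartite {n : ℕ} (D : Digraph n) : Set where
  field
    part   : Fin n → Bool
    sizeX  : count part ≡ ⌈ n /2⌉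
    sizeY  : count (λ v → not (part v)) ≡ ⌊ n /2⌋
    inside : ∀ u v → part u ≡ part v → arc D u v ≡ false
    across : ∀ u v → part u ≢ part v →
             (arc D u v ≡ true × arc D v u ≡ false) ⊎ (arc D u v ≡ false × arc D v u ≡ true)
    dir    : Bool
    matching : ∀ u v u′ v′ → arc D u v ≡ true → arc D u′ v′ ≡ true →
               part u ≢ dir → part u′ ≢ dir →
               (u ≡ u′ → v ≡ v′) × (v ≡ v′ → u ≡ u′)

NumExtremalClasses : ℕ → ℕ → Set
NumExtremalClasses n N = Σ (List (Digraph n)) λ L →
  (length L ≡ N) × All Extremal2 L × AllPairs (λ G H → ¬ (G ≅ H)) L ×
  (∀ (G : Digraph n) → Extremal2 G → Any (λ H → G ≅ H) L)

{-# OPTIONS --safe #-}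

-- Two triangles sharing an edge cannot be oriented 2-geodetically, so a vertex outside a (necessarily
-- cyclic) triangle has at most one neighbour in it.  Deleting a triangle from n vertices therefore costs
-- at most n arcs, which is less than ⌊n²/4⌋ − ⌊(n−3)²/4⌋ for n ≥ 7; without triangles Mantel's bound
-- applies, and equality forces a balanced complete bipartite underlying graph with parts X, Y, |X| ≥ 4.
-- There every y ∈ Y has at most one out-neighbour, or every y ∈ Y has at most one in-neighbour: otherwise
-- a path of length 2 is duplicated.  The same argument then makes the minority arcs a matching.
-- Such a digraph is determined up to isomorphism by which part is the source part and by the number k of
-- reversed arcs, and both are read off the outdegrees: exactly the sources have outdegree at least 2 and
-- exactly k vertices have outdegree 1.
module Submission where

open import Defs
open import Data.Bool using (Bool; true; false; if_then_else_; not; _∧_; _∨_)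
import Data.Bool.Properties as Bool
open import Data.Empty using (⊥; ⊥-elim)
open import Data.Fin using (Fin; zero; suc; punchIn; punchOut; splitAt)
open import Data.Fin.Permutation using (Permutation; Permutation′; _⟨$⟩ʳ_; cast-id; insert; insert-punchIn)
import Data.Fin.Permutation as Perm
open import Data.Fin.Properties using
  (_≟_; any?; suc-injective; punchIn-injective; punchInᵢ≢i; punchIn-punchOut; punchOut-injective; +↔⊎; cast-is-id)
open import Data.List using (List; []; _∷_; map; allFin; tabulate; applyUpTo; _++_)
import Data.List.Properties as List
open import Data.List.Relation.Unary.All using (All)
import Data.List.Relation.Unary.All.Properties as All
open import Data.List.Relation.Unary.AllPairs using (AllPairs)
import Data.List.Relation.Unary.AllPairs.Properties as AllPairs
open import Data.List.Relation.Unary.Any using (Any)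
import Data.List.Relation.Unary.Any.Properties as Any
open import Data.Nat using (ℕ; zero; suc; _+_; _*_; _≤_; _<_; z≤n; s≤s; ⌊_/2⌋; ⌈_/2⌉; _/_; _%_)
open import Data.Nat.DivMod using (m≡m%n+[m/n]*n)
open import Data.Nat.Induction using (<-rec)
import Data.Nat.ListAction as ListAction
open import Data.Nat.Properties hiding (_≟_; suc-injective)
open import Data.Nat.Tactic.RingSolver using (solve-∀)
open import Algebra.Properties.Semiring.Sum +-*-semiring
open import Data.Product using (Σ; _×_; _,_; ∃; proj₁; proj₂)
open import Data.Sum using (_⊎_; inj₁; inj₂; [_,_]′)
import Data.Sum as Sum
open import Data.Sum.Function.Propositional using (_⊎-↔_)
open import Data.Sum.Properties using (inj₁-injective; inj₂-injective)
open import Function using (_∘_; id; _↔_; Inverse; Injection; mk↔ₛ′)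
open import Function.Construct.Composition using (_↔-∘_)
open import Function.Construct.Symmetry using (↔-sym)
open import Function.Properties.Inverse using (↔⇒↣)
open import Relation.Binary.PropositionalEquality
open import Relation.Nullary using (¬_; yes; no)
open import Relation.Nullary.Decidable using (_×-dec_; ¬?)

private variable
  m n p q k : ℕ

-- Finite sums and counting.

𝟙 : Bool → ℕ
𝟙 b = if b then 1 else 0

𝟙≤1 : ∀ b → 𝟙 b ≤ 1
𝟙≤1 true  = ≤-refl
𝟙≤1 false = z≤n

sum-mono : {f g : Fin n → ℕ} → (∀ i → f i ≤ g i) → sum f ≤ sum g
sum-mono {zero}  f≤g = z≤n
sum-mono {suc n} f≤g = +-mono-≤ (f≤g zero) (sum-mono (f≤g ∘ suc))

sum-const : ∀ n c → sum {n} (λ _ → c) ≡ n * c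
sum-const zero    c = refl
sum-const (suc n) c = cong (c +_) (sum-const n c)

sum-zero : ∀ n → sum {n} (λ _ → 0) ≡ 0
sum-zero n = trans (sum-const n 0) (*-zeroʳ n)

-- One strict term would make the total strict. Equality cases of summed estimates are read off
-- termwise in this way.
sum-rigid : {f g : Fin n → ℕ} → (∀ i → f i ≤ g i) → sum g ≤ sum f → ∀ i → f i ≡ g i
sum-rigid {suc n} {f} {g} f≤g g≤f zero = ≤-antisym (f≤g zero)
  (+-cancelʳ-≤ (sum (g ∘ suc)) _ _ (≤-trans g≤f (+-monoʳ-≤ (f zero) (sum-mono (f≤g ∘ suc)))))
sum-rigid {suc n} {f} {g} f≤g g≤f (suc i) = sum-rigid (f≤g ∘ suc)
  (+-cancelˡ-≤ (g zero) _ _ (≤-trans g≤f (+-monoˡ-≤ (sum (f ∘ suc)) (f≤g zero)))) i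

count-atMostOne : (p : Fin n → Bool) → (∀ i j → p i ≡ true → p j ≡ true → i ≡ j) → sum (𝟙 ∘ p) ≤ 1
count-atMostOne {zero}  p uniq = z≤n
count-atMostOne {suc n} p uniq with p zero in p₀
... | true  = ≤-reflexive (cong suc (trans (sum-cong-≗ none) (sum-zero n)))
  where
  none : ∀ i → 𝟙 (p (suc i)) ≡ 0
  none i with p (suc i) in pᵢ
  ... | true  with () ← uniq zero (suc i) p₀ pᵢ
  ... | false = refl
... | false = count-atMostOne (p ∘ suc) λ i j pᵢ pⱼ → suc-injective (uniq (suc i) (suc j) pᵢ pⱼ)

sum-map-allFin : (f : Fin n → ℕ) → ListAction.sum (map f (allFin n)) ≡ sum f
sum-map-allFin {n} f = trans (cong ListAction.sum (List.map-tabulate (λ i → i) f)) (go f)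
  where
  go : ∀ {n} (f : Fin n → ℕ) → ListAction.sum (tabulate f) ≡ sum f
  go {zero}  f = refl
  go {suc n} f = cong (f zero +_) (go (f ∘ suc))

count≡sum : (p : Fin n → Bool) → count p ≡ sum (𝟙 ∘ p)
count≡sum p = sum-map-allFin (𝟙 ∘ p)

arcs : (Fin n → Fin n → Bool) → ℕ
arcs {n} A = ∑[ u < n ] ∑[ v < n ] 𝟙 (A u v)

size≡arcs : (G : Digraph n) → size G ≡ arcs (arc G)
size≡arcs G = trans (sum-map-allFin (λ u → count (arc G u))) (sum-cong-≗ (λ u → count≡sum (arc G u)))

-- Geodeticity as forbidden configurations of arcs.

-- Distinct walks of length at most 2 with common ends have lengths 0 and 2, 1 and 2, or 2 and 2,
-- one field for each; lengths 0 and 1 mean a loop, excluded by `oriented` at `u = v`. The vertex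
-- type is arbitrary so that disjoint unions of two parts can serve as vertex sets too.
record Geodetic₂ {V : Set} (A : V → V → Bool) : Set where
  field
    oriented   : ∀ {u v} → A u v ≡ true → A v u ≡ true → ⊥
    noShortcut : ∀ {u v w} → A u v ≡ true → A v w ≡ true → A u w ≡ true → ⊥
    uniqueMid  : ∀ {u v v′ w} → A u v ≡ true → A v w ≡ true → A u v′ ≡ true → A v′ w ≡ true → v ≡ v′

arc⇒≢ : {V : Set} {A : V → V → Bool} → Geodetic₂ A → ∀ {u v} → A u v ≡ true → u ≢ v
arc⇒≢ geo uv refl = Geodetic₂.oriented geo uv uv

geodetic⇒ : (G : Digraph n) → Geodetic 2 G → Geodetic₂ (arc G)
geodetic⇒ G geo = record
  { oriented   = λ {u} {v} uv vu → case-[] (geo u u [] (v ∷ u ∷ []) z≤n ≤-refl refl (uv , vu , refl))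
  ; noShortcut = λ {u} {v} {w} uv vw uw →
      case-[] (List.∷-injectiveʳ (geo u w (w ∷ []) (v ∷ w ∷ []) (s≤s z≤n) ≤-refl (uw , refl) (uv , vw , refl)))
  ; uniqueMid  = λ {u} {v} {v′} {w} uv vw uv′ v′w →
      List.∷-injectiveˡ (geo u w (v ∷ w ∷ []) (v′ ∷ w ∷ []) ≤-refl ≤-refl (uv , vw , refl) (uv′ , v′w , refl))
  }
  where
  case-[] : ∀ {A : Set} {x : A} {xs} → [] ≡ x ∷ xs → ⊥
  case-[] ()

⇒geodetic : (G : Digraph n) → Geodetic₂ (arc G) → Geodetic 2 G
⇒geodetic G geo = go
  where
  open Geodetic₂ geo
  noLoop : ∀ {v} → arc G v v ≡ true → ⊥
  noLoop {v} vv with () ← trans (sym vv) (loopless G v)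
  go : Geodetic 2 G
  go u v []          []              _ _ _ _ = refl
  go u v []          (x ∷ [])        _ _ refl (ux , refl) = ⊥-elim (noLoop ux)
  go u v []          (x ∷ y ∷ [])    _ _ refl (ux , xy , refl) = ⊥-elim (oriented ux xy)
  go u v (x ∷ [])    []              _ _ (ux , refl) refl = ⊥-elim (noLoop ux)
  go u v (x ∷ y ∷ []) []             _ _ (ux , xy , refl) refl = ⊥-elim (oriented ux xy)
  go u v (x ∷ [])    (y ∷ [])        _ _ (_ , refl) (_ , refl) = refl
  go u v (x ∷ [])    (y ∷ z ∷ [])    _ _ (ux , refl) (uy , yz , refl) = ⊥-elim (noShortcut uy yz ux)
  go u v (y ∷ z ∷ []) (x ∷ [])       _ _ (uy , yz , refl) (ux , refl) = ⊥-elim (noShortcut uy yz ux)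
  go u v (x ∷ y ∷ []) (x′ ∷ y′ ∷ []) _ _ (ux , xy , refl) (ux′ , xy′ , refl) = cong (_∷ v ∷ []) (uniqueMid ux xy ux′ xy′)
  go u v (_ ∷ _ ∷ _ ∷ _) _ (s≤s (s≤s ())) _ _ _
  go u v _ (_ ∷ _ ∷ _ ∷ _) _ (s≤s (s≤s ())) _ _

geodetic-restrict : {V W : Set} {A : V → V → Bool} (ι : W → V) → (∀ {x y} → ι x ≡ ι y → x ≡ y) →
  Geodetic₂ A → Geodetic₂ (λ x y → A (ι x) (ι y))
geodetic-restrict ι ι-inj geo = record
  { oriented = oriented ; noShortcut = noShortcut
  ; uniqueMid = λ a b c d → ι-inj (uniqueMid a b c d) }
  where open Geodetic₂ geo

-- Deletion of a cyclic triangle.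

distinct₃⇒3≤ : {a b c : Fin n} → a ≢ b → a ≢ c → b ≢ c → ∃ λ m → n ≡ 3 + m
distinct₃⇒3≤ {suc zero} {zero} {zero} a≢b _ _ = ⊥-elim (a≢b refl)
distinct₃⇒3≤ {suc (suc zero)} a≢b a≢c b≢c with zero ← punchOut a≢b in e | zero ← punchOut a≢c in e′ =
  ⊥-elim (b≢c (punchOut-injective a≢b a≢c (trans e (sym e′))))
distinct₃⇒3≤ {suc (suc (suc m))} _ _ _ = m , refl

record Complement₃ {m} (a b c : Fin (3 + m)) : Set where
  field
    ι        : Fin m → Fin (3 + m)
    ι-inj    : ∀ {i j} → ι i ≡ ι j → i ≡ j
    ι≢a      : ∀ i → ι i ≢ a
    ι≢b      : ∀ i → ι i ≢ b
    ι≢c      : ∀ i → ι i ≢ c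
    sum-split : ∀ f → sum f ≡ f a + (f b + (f c + sum (f ∘ ι)))

complement₃ : {a b c : Fin (3 + m)} → a ≢ b → a ≢ c → b ≢ c → Complement₃ a b c
complement₃ {m} {a} {b} {c} a≢b a≢c b≢c = record
  { ι = λ i → punchIn a (punchIn b′ (punchIn c″ i))
  ; ι-inj = punchIn-injective c″ _ _ ∘ punchIn-injective b′ _ _ ∘ punchIn-injective a _ _
  ; ι≢a = λ i → punchInᵢ≢i a _
  ; ι≢b = λ i e → punchInᵢ≢i b′ _ (punchIn-injective a _ _ (trans e (sym eb)))
  ; ι≢c = λ i e → punchInᵢ≢i c″ _ (punchIn-injective b′ _ _ (punchIn-injective a _ _ (trans e (sym ec))))
  ; sum-split = split
  }
  where
  b′ c′ : Fin (2 + m)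
  b′ = punchOut a≢b
  c′ = punchOut a≢c
  b′≢c′ : b′ ≢ c′
  b′≢c′ = b≢c ∘ punchOut-injective a≢b a≢c
  c″ : Fin (1 + m)
  c″ = punchOut b′≢c′
  eb : punchIn a b′ ≡ b
  eb = punchIn-punchOut a≢b
  ec : punchIn a (punchIn b′ c″) ≡ c
  ec = trans (cong (punchIn a) (punchIn-punchOut b′≢c′)) (punchIn-punchOut a≢c)
  split : ∀ f → sum f ≡ f a + (f b + (f c + sum (λ i → f (punchIn a (punchIn b′ (punchIn c″ i))))))
  split f rewrite sum-remove {i = a} f | sum-remove {i = b′} (f ∘ punchIn a)
                | sum-remove {i = c″} (f ∘ punchIn a ∘ punchIn b′) | eb | ec = refl

true≢false : ∀ {b} → b ≡ true → b ≡ false → ⊥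
true≢false refl ()

¬true⇒false : ∀ {b} → ¬ (b ≡ true) → b ≡ false
¬true⇒false {true}  ¬b = ⊥-elim (¬b refl)
¬true⇒false {false} ¬b = refl

Adj : {V : Set} → (V → V → Bool) → V → V → Set
Adj A u v = A u v ≡ true ⊎ A v u ≡ true

record CyclicTriangle {V : Set} (A : V → V → Bool) (a b c : V) : Set where
  constructor cyclic
  field
    ab : A a b ≡ true
    bc : A b c ≡ true
    ca : A c a ≡ true

rotate : ∀ {V : Set} {A : V → V → Bool} {a b c} → CyclicTriangle A a b c → CyclicTriangle A b c a
rotate (cyclic ab bc ca) = cyclic bc ca ab

adj-sum : ∀ x y x′ y′ → (x ≡ true → y ≡ true → ⊥) → (x′ ≡ true → y′ ≡ true → ⊥) →
  ((x ≡ true ⊎ y ≡ true) → (x′ ≡ true ⊎ y′ ≡ true) → ⊥) → (𝟙 x + 𝟙 y) + (𝟙 x′ + 𝟙 y′) ≤ 1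
adj-sum true  true  _ _ h _ _ = ⊥-elim (h refl refl)
adj-sum _ _ true  true  _ h _ = ⊥-elim (h refl refl)
adj-sum true  _ true  _ _ _ h = ⊥-elim (h (inj₁ refl) (inj₁ refl))
adj-sum true  _ _ true  _ _ h = ⊥-elim (h (inj₁ refl) (inj₂ refl))
adj-sum _ true  true  _ _ _ h = ⊥-elim (h (inj₂ refl) (inj₁ refl))
adj-sum _ true  _ true  _ _ h = ⊥-elim (h (inj₂ refl) (inj₂ refl))
adj-sum false false false false _ _ _ = z≤n
adj-sum true  false false false _ _ _ = ≤-refl
adj-sum false true  false false _ _ _ = ≤-refl
adj-sum false false true  false _ _ _ = ≤-refl
adj-sum false false false true  _ _ _ = ≤-refl

pairwise≤1 : ∀ x y z → x + y ≤ 1 → y + z ≤ 1 → z + x ≤ 1 → x + (y + z) ≤ 1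
pairwise≤1 zero    y z xy yz zx = yz
pairwise≤1 (suc x) zero z xy yz zx = subst (_≤ 1) (+-comm z (suc x)) zx
pairwise≤1 (suc x) (suc y) z (s≤s xy) yz zx with () ← subst (_≤ 0) (+-suc x y) xy

module Triangle {n} {A : Fin n → Fin n → Bool} (geo : Geodetic₂ A) where
  open Geodetic₂ geo

  #edges : Fin n → Fin n → ℕ
  #edges u v = 𝟙 (A u v) + 𝟙 (A v u)

  -- Three of the four orientations of the edges `aw` and `bw` put an arc beside a 2-walk with the
  -- same ends. The fourth, `b → w → a`, competes with `b → c → a`.
  triangle-neighbour : ∀ {a b c w} → CyclicTriangle A a b c → w ≢ c → Adj A a w → Adj A b w → ⊥
  triangle-neighbour (cyclic ab bc ca) w≢c (inj₁ aw) (inj₁ bw) = noShortcut ab bw aw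
  triangle-neighbour (cyclic ab bc ca) w≢c (inj₁ aw) (inj₂ wb) = noShortcut aw wb ab
  triangle-neighbour (cyclic ab bc ca) w≢c (inj₂ wa) (inj₁ bw) = w≢c (uniqueMid bw wa bc ca)
  triangle-neighbour (cyclic ab bc ca) w≢c (inj₂ wa) (inj₂ wb) = noShortcut wa ab wb

  triangle-pair : ∀ {a b c w} → CyclicTriangle A a b c → w ≢ c → #edges a w + #edges b w ≤ 1
  triangle-pair {a} {b} {c} {w} t w≢c =
    adj-sum (A a w) (A w a) (A b w) (A w b) oriented oriented (triangle-neighbour t w≢c)

  triangle-degree : ∀ {a b c w} → CyclicTriangle A a b c → w ≢ a → w ≢ b → w ≢ c →
    #edges a w + (#edges b w + #edges c w) ≤ 1
  triangle-degree {a} {b} {c} {w} t w≢a w≢b w≢c =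
    pairwise≤1 (#edges a w) (#edges b w) (#edges c w)
      (triangle-pair t w≢c) (triangle-pair (rotate t) w≢a) (triangle-pair (rotate (rotate t)) w≢b)

-- The triangle has 3 arcs, and each of the other `m` vertices is joined to it by at most one arc,
-- so at most `3 + m` arcs disappear.
triangle-removal₃₊ : {A : Fin (3 + m) → Fin (3 + m) → Bool} → Geodetic₂ A → ∀ {a b c} → CyclicTriangle A a b c →
  Σ (Fin m → Fin m → Bool) λ A′ → Geodetic₂ A′ × arcs A ≤ 3 + m + arcs A′
triangle-removal₃₊ {m} {A} geo {a} {b} {c} t@(cyclic ab bc ca) = A′ , geodetic-restrict ι ι-inj geo , bound
  where
  open Geodetic₂ geo
  open Triangle geo
  open Complement₃ (complement₃ (arc⇒≢ geo ab) (≢-sym (arc⇒≢ geo ca)) (arc⇒≢ geo bc))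
  A′ : Fin m → Fin m → Bool
  A′ i j = A (ι i) (ι j)
  x : Fin (3 + m) → Fin (3 + m) → ℕ
  x u v = 𝟙 (A u v)
  row : ∀ u → sum (x u) ≡ x u a + (x u b + (x u c + sum (x u ∘ ι)))
  row u = sum-split (x u)
  -- `T u` counts the arcs with tail `u` and `H u` those with head `u` whose other end is outside
  -- the triangle.
  T H : Fin (3 + m) → ℕ
  T u = ∑[ i < m ] x u (ι i)
  H u = ∑[ i < m ] x (ι i) u
  rows : ∑[ i < m ] sum (x (ι i)) ≡
    ∑[ i < m ] x (ι i) a + (∑[ i < m ] x (ι i) b + (∑[ i < m ] x (ι i) c + arcs A′))
  rows = trans (sum-cong-≗ (row ∘ ι))
    (trans (∑-distrib-+ (λ i → x (ι i) a) _) (cong (H a +_)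
      (trans (∑-distrib-+ (λ i → x (ι i) b) _) (cong (H b +_) (∑-distrib-+ (λ i → x (ι i) c) _)))))
  deg-split : ∀ u → ∑[ i < m ] #edges u (ι i) ≡ T u + H u
  deg-split u = ∑-distrib-+ (λ i → x u (ι i)) _
  cross : (T a + H a) + ((T b + H b) + (T c + H c)) ≤ m
  cross = begin
    (T a + H a) + ((T b + H b) + (T c + H c))
      ≡⟨ cong₂ _+_ (deg-split a) (cong₂ _+_ (deg-split b) (deg-split c)) ⟨
    sum (#edges a ∘ ι) + (sum (#edges b ∘ ι) + sum (#edges c ∘ ι))
      ≡⟨ cong (sum (#edges a ∘ ι) +_) (∑-distrib-+ (#edges b ∘ ι) _) ⟨
    sum (#edges a ∘ ι) + ∑[ i < m ] (#edges b (ι i) + #edges c (ι i))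
      ≡⟨ ∑-distrib-+ (#edges a ∘ ι) _ ⟨
    ∑[ i < m ] (#edges a (ι i) + (#edges b (ι i) + #edges c (ι i)))
      ≤⟨ sum-mono (λ i → triangle-degree t (ι≢a i) (ι≢b i) (ι≢c i)) ⟩
    ∑[ i < m ] 1
      ≡⟨ trans (sum-const m 1) (*-identityʳ m) ⟩
    m ∎
    where open ≤-Reasoning
  false⇒0 : ∀ {u v} → (A u v ≡ true → ⊥) → x u v ≡ 0
  false⇒0 h = cong 𝟙 (¬true⇒false h)
  noLoop : ∀ {v} → A v v ≡ true → ⊥
  noLoop vv = oriented vv vv
  collect : ∀ a b c a′ b′ c′ s → (1 + a) + ((1 + b) + ((1 + c) + (a′ + (b′ + (c′ + s)))))
    ≡ 3 + ((a + a′) + ((b + b′) + (c + c′))) + s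
  collect = solve-∀
  row-a : sum (x a) ≡ 1 + T a
  row-a = trans (row a) (cong₂ _+_ (false⇒0 noLoop) (cong₂ _+_ (cong 𝟙 ab) (cong (_+ T a) (false⇒0 (oriented ca)))))
  row-b : sum (x b) ≡ 1 + T b
  row-b = trans (row b) (cong₂ _+_ (false⇒0 (oriented ab)) (cong₂ _+_ (false⇒0 noLoop) (cong (_+ T b) (cong 𝟙 bc))))
  row-c : sum (x c) ≡ 1 + T c
  row-c = trans (row c) (cong₂ _+_ (cong 𝟙 ca) (cong₂ _+_ (false⇒0 (oriented bc)) (cong (_+ T c) (false⇒0 noLoop))))
  bound : arcs A ≤ 3 + m + arcs A′
  bound = begin
    arcs A
      ≡⟨ sum-split (sum ∘ x) ⟩
    sum (x a) + (sum (x b) + (sum (x c) + ∑[ i < m ] sum (x (ι i))))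
      ≡⟨ cong₂ _+_ row-a (cong₂ _+_ row-b (cong₂ _+_ row-c rows)) ⟩
    (1 + T a) + ((1 + T b) + ((1 + T c) + (H a + (H b + (H c + arcs A′)))))
      ≡⟨ collect (T a) (T b) (T c) (H a) (H b) (H c) (arcs A′) ⟩
    3 + ((T a + H a) + ((T b + H b) + (T c + H c))) + arcs A′
      ≤⟨ +-monoˡ-≤ (arcs A′) (+-monoʳ-≤ 3 cross) ⟩
    3 + m + arcs A′ ∎
    where open ≤-Reasoning

triangle-removal : {A : Fin n → Fin n → Bool} → Geodetic₂ A → ∀ {a b c} → CyclicTriangle A a b c →
  ∃ λ m → n ≡ 3 + m × Σ (Fin m → Fin m → Bool) λ A′ → Geodetic₂ A′ × arcs A ≤ n + arcs A′
triangle-removal geo t@(cyclic ab bc ca)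
  with distinct₃⇒3≤ (arc⇒≢ geo ab) (≢-sym (arc⇒≢ geo ca)) (arc⇒≢ geo bc)
... | m , refl = m , refl , triangle-removal₃₊ geo t

-- Arithmetic of the balanced product.

-- This is `⌊n²/4⌋`; the product form suits induction in steps of two.
turán : ℕ → ℕ
turán n = ⌊ n /2⌋ * ⌈ n /2⌉

suc*suc : ∀ p q → suc p * suc q ≡ p * q + suc (p + q)
suc*suc = solve-∀

turán-+2 : ∀ n → turán (2 + n) ≡ turán n + suc n
turán-+2 n = trans (suc*suc ⌊ n /2⌋ ⌈ n /2⌉) (cong (λ s → turán n + suc s) (⌊n/2⌋+⌈n/2⌉≡n n))

turán-+1 : ∀ n → turán (1 + n) ≡ turán n + ⌈ n /2⌉
turán-+1 n = identity ⌊ n /2⌋ ⌈ n /2⌉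
  where
  identity : ∀ f c → c * suc f ≡ f * c + c
  identity = solve-∀

turán-+3 : ∀ m → turán (3 + m) ≡ turán m + ⌈ m /2⌉ + (2 + m)
turán-+3 m = trans (turán-+2 (suc m)) (cong (_+ (2 + m)) (turán-+1 m))

-- The triangle is the only exception to ⌊n²/4⌋.
bound : ℕ → ℕ
bound 3 = 3
bound n = turán n

turán≤bound : ∀ n → turán n ≤ bound n
turán≤bound 0 = ≤-refl
turán≤bound 1 = ≤-refl
turán≤bound 2 = ≤-refl
turán≤bound 3 = n≤1+n 2
turán≤bound (suc (suc (suc (suc n)))) = ≤-refl

bound≡turán : 4 ≤ n → bound n ≡ turán n
bound≡turán (s≤s (s≤s (s≤s (s≤s _)))) = refl

-- Three more vertices add `⌈ m /2⌉ + (2 + m)`, and `⌈ m /2⌉` is at least 2 once `4 ≤ m`.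
turán-step-< : 4 ≤ m → 3 + m + turán m < turán (3 + m)
turán-step-< {m} 4≤m = begin-strict
  3 + m + turán m               ≡⟨ shift m (turán m) ⟩
  turán m + 1 + (2 + m)         <⟨ +-monoˡ-< (2 + m) (+-monoʳ-< (turán m) (⌈n/2⌉-mono 4≤m)) ⟩
  turán m + ⌈ m /2⌉ + (2 + m)   ≡⟨ turán-+3 m ⟨
  turán (3 + m)                 ∎
  where
  open ≤-Reasoning
  shift : ∀ m t → 3 + m + t ≡ t + 1 + (2 + m)
  shift = solve-∀

-- For `m ≤ 3` both sides coincide, including `m = 0` and `m = 3`, where the exceptional value 3
-- occurs; from `m = 4` on the inequality is strict.
bound-step : ∀ m → 3 + m + bound m ≤ bound (3 + m)
bound-step 0 = ≤-refl
bound-step 1 = ≤-refl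
bound-step 2 = ≤-refl
bound-step 3 = ≤-refl
bound-step (suc (suc (suc (suc k)))) = <⇒≤ (turán-step-< {4 + k} (s≤s (s≤s (s≤s (s≤s z≤n)))))

-- Passing from `p`, `q` to `suc p`, `suc q` adds `suc (p + q)` to both sides, which leaves only the
-- case of a zero factor.
p*q≤turán : ∀ p q → p * q ≤ turán (p + q)
p*q≤turán zero    q    = z≤n
p*q≤turán (suc p) zero rewrite *-zeroʳ p = z≤n
p*q≤turán (suc p) (suc q) rewrite +-suc p q | turán-+2 (p + q) | suc*suc p q =
  +-monoˡ-≤ (suc (p + q)) (p*q≤turán p q)

-- The same descent keeps the difference of the factors; when one factor reaches zero, equality
-- leaves at most 1 for the other.
p*q≡turán⇒balanced : ∀ p q → turán (p + q) ≤ p * q →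
  (p ≡ ⌈ p + q /2⌉ × q ≡ ⌊ p + q /2⌋) ⊎ (p ≡ ⌊ p + q /2⌋ × q ≡ ⌈ p + q /2⌉)
p*q≡turán⇒balanced zero zero          _ = inj₁ (refl , refl)
p*q≡turán⇒balanced zero (suc zero)    _ = inj₂ (refl , refl)
p*q≡turán⇒balanced (suc zero) zero    _ = inj₁ (refl , refl)
p*q≡turán⇒balanced (suc (suc p)) zero t≤ rewrite *-zeroʳ p with () ← t≤
p*q≡turán⇒balanced (suc p) (suc q) t≤ rewrite +-suc p q | turán-+2 (p + q) | suc*suc p q
  with p*q≡turán⇒balanced p q (+-cancelʳ-≤ (suc (p + q)) _ _ t≤)
... | inj₁ (ep , eq) = inj₁ (cong suc ep , cong suc eq)
... | inj₂ (ep , eq) = inj₂ (cong suc ep , cong suc eq)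

-- Mantel's theorem and its equality case.

argmax : (f : Fin (suc n) → ℕ) → ∃ λ v → ∀ u → f u ≤ f v
argmax {zero}  f = zero , λ { zero → ≤-refl }
argmax {suc n} f with argmax (f ∘ suc)
... | v , max with ≤-total (f zero) (f (suc v))
...   | inj₁ f₀≤ = suc v , λ { zero → f₀≤ ; (suc u) → max u }
...   | inj₂ ≤f₀ = zero , λ { zero → ≤-refl ; (suc u) → ≤-trans (max u) ≤f₀ }

record Balanced {n} (A : Fin n → Fin n → Bool) : Set where
  field
    part   : Fin n → Bool
    sizeX  : sum (𝟙 ∘ part) ≡ ⌈ n /2⌉
    sizeY  : sum (𝟙 ∘ not ∘ part) ≡ ⌊ n /2⌋
    inside : ∀ {u v} → part u ≡ part v → A u v ≡ false
    across : ∀ {u v} → part u ≢ part v → Adj A u v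

TriangleFree : {V : Set} → (V → V → Bool) → Set
TriangleFree A = ∀ {a b c} → ¬ CyclicTriangle A a b c

-- Mantel's theorem: every arc meets the complement B of the neighbourhood N of a vertex c of maximum
-- degree Δ, so there are at most |B| Δ arcs.
module Mantel {n} {A : Fin n → Fin n → Bool} (geo : Geodetic₂ A) (triangleFree : TriangleFree A) where
  open Geodetic₂ geo

  x : Fin n → Fin n → ℕ
  x u v = 𝟙 (A u v)

  adj : Fin n → Fin n → Bool
  adj u v = A u v ∨ A v u

  adj⇒Adj : ∀ {u v} → adj u v ≡ true → Adj A u v
  adj⇒Adj {u} {v} e with A u v
  ... | true  = inj₁ refl
  ... | false = inj₂ e

  𝟙-adj : ∀ u v → 𝟙 (adj u v) ≡ x u v + x v u
  𝟙-adj u v with A u v in uv | A v u in vu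
  ... | true  | true  = ⊥-elim (oriented uv vu)
  ... | true  | false = refl
  ... | false | true  = refl
  ... | false | false = refl

  degree : Fin n → ℕ
  degree u = ∑[ v < n ] 𝟙 (adj u v)

  -- In a weighted degree sum each arc is counted once at its tail and once at its head.
  handshake : ∀ (w : Fin n → ℕ) →
    ∑[ u < n ] (w u * degree u) ≡ ∑[ u < n ] ∑[ v < n ] ((w u + w v) * x u v)
  handshake w = begin
    ∑[ u < n ] (w u * degree u)
      ≡⟨ sum-cong-≗ (λ u → *-distribˡ-sum (w u) (𝟙 ∘ adj u)) ⟩
    ∑[ u < n ] ∑[ v < n ] (w u * 𝟙 (adj u v))
      ≡⟨ sum-cong-≗ (λ u → sum-cong-≗ (λ v → trans (cong (w u *_) (𝟙-adj u v)) (*-distribˡ-+ (w u) (x u v) (x v u)))) ⟩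
    ∑[ u < n ] ∑[ v < n ] (w u * x u v + w u * x v u)
      ≡⟨ split (λ u v → w u * x u v) (λ u v → w u * x v u) ⟩
    ∑[ u < n ] ∑[ v < n ] (w u * x u v) + ∑[ u < n ] ∑[ v < n ] (w u * x v u)
      ≡⟨ cong (∑[ u < n ] ∑[ v < n ] (w u * x u v) +_) (∑-comm (λ u v → w u * x v u)) ⟩
    ∑[ u < n ] ∑[ v < n ] (w u * x u v) + ∑[ u < n ] ∑[ v < n ] (w v * x u v)
      ≡⟨ split (λ u v → w u * x u v) (λ u v → w v * x u v) ⟨
    ∑[ u < n ] ∑[ v < n ] (w u * x u v + w v * x u v)
      ≡⟨ sum-cong-≗ (λ u → sum-cong-≗ (λ v → *-distribʳ-+ (x u v) (w u) (w v))) ⟨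
    ∑[ u < n ] ∑[ v < n ] ((w u + w v) * x u v) ∎
    where
    open ≡-Reasoning
    split : ∀ (f g : Fin n → Fin n → ℕ) →
      ∑[ u < n ] ∑[ v < n ] (f u v + g u v) ≡ ∑[ u < n ] ∑[ v < n ] f u v + ∑[ u < n ] ∑[ v < n ] g u v
    split f g = trans (sum-cong-≗ (λ u → ∑-distrib-+ (f u) (g u))) (∑-distrib-+ (sum ∘ f) (sum ∘ g))

  -- An arc between two neighbours of `c` would complete a triangle, which is either cyclic or
  -- contains a shortcut.
  neighbours-independent : ∀ {c u v} → Adj A c u → Adj A c v → A u v ≡ true → ⊥
  neighbours-independent (inj₁ cu) (inj₁ cv) uv = noShortcut cu uv cv
  neighbours-independent (inj₁ cu) (inj₂ vc) uv = triangleFree (cyclic cu uv vc)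
  neighbours-independent (inj₂ uc) (inj₁ cv) uv = noShortcut uc cv uv
  neighbours-independent (inj₂ uc) (inj₂ vc) uv = noShortcut uv vc uc

  module _ (c : Fin n) (max : ∀ u → degree u ≤ degree c) where
    N : Fin n → Bool
    N = adj c

    b : Fin n → ℕ
    b = 𝟙 ∘ not ∘ N

    Δ |B| : ℕ
    Δ = degree c
    |B| = sum b

    Δ+|B|≡n : Δ + |B| ≡ n
    Δ+|B|≡n = trans (sym (∑-distrib-+ (𝟙 ∘ N) b))
      (trans (sum-cong-≗ (λ u → complement (N u))) (trans (sum-const n 1) (*-identityʳ n)))
      where
      complement : ∀ t → 𝟙 t + 𝟙 (not t) ≡ 1
      complement true  = refl
      complement false = refl

    covered : ∀ u v → x u v ≤ (b u + b v) * x u v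
    covered u v with A u v in uv | N u in cu | N v in cv
    ... | false | _     | _     = z≤n
    ... | true  | true  | true  = ⊥-elim (neighbours-independent (adj⇒Adj cu) (adj⇒Adj cv) uv)
    ... | true  | true  | false = ≤-refl
    ... | true  | false | true  = ≤-refl
    ... | true  | false | false = s≤s z≤n

    B-degrees : ∑[ u < n ] (b u * degree u) ≤ |B| * Δ
    B-degrees = begin
      ∑[ u < n ] (b u * degree u) ≤⟨ sum-mono (λ u → *-monoʳ-≤ (b u) (max u)) ⟩
      ∑[ u < n ] (b u * Δ)        ≡⟨ *-distribʳ-sum Δ b ⟨
      |B| * Δ                   ∎
      where open ≤-Reasoning

    arcs≤ : arcs A ≤ ∑[ u < n ] (b u * degree u)
    arcs≤ = begin
      arcs A                                         ≤⟨ sum-mono (λ u → sum-mono (covered u)) ⟩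
      ∑[ u < n ] ∑[ v < n ] ((b u + b v) * x u v)      ≡⟨ handshake b ⟨
      ∑[ u < n ] (b u * degree u)                      ∎
      where open ≤-Reasoning

    |B|*Δ≤turán : |B| * Δ ≤ turán n
    |B|*Δ≤turán = subst (λ k → |B| * Δ ≤ turán k) (trans (+-comm |B| Δ) Δ+|B|≡n) (p*q≤turán |B| Δ)

    arcs≤turán : arcs A ≤ turán n
    arcs≤turán = ≤-trans arcs≤ (≤-trans B-degrees |B|*Δ≤turán)

    module _ (tight : turán n ≤ arcs A) where
      -- With `turán n` arcs the whole chain of estimates collapses, first for each row and then for
      -- each pair. Hence no arc has both ends outside `N`, since it would be counted twice.
      covered-once : ∀ u v → x u v ≡ (b u + b v) * x u v
      covered-once u = sum-rigid (covered u) (≤-reflexive (sym (sum-rigid (λ u → sum-mono (covered u)) total u)))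
        where
        total : ∑[ u < n ] ∑[ v < n ] ((b u + b v) * x u v) ≤ arcs A
        total = subst (_≤ arcs A) (handshake b) (≤-trans B-degrees (≤-trans |B|*Δ≤turán tight))

      full-degree : ∀ u → b u * degree u ≡ b u * Δ
      full-degree = sum-rigid (λ u → *-monoʳ-≤ (b u) (max u))
        (≤-trans (≤-reflexive (sym (*-distribʳ-sum Δ b))) (≤-trans |B|*Δ≤turán (≤-trans tight arcs≤)))

      inside-N : ∀ {u v} → N u ≡ N v → A u v ≡ false
      inside-N {u} {v} e with A u v in uv | N u in cu | N v in cv | covered-once u v
      ... | false | _     | _     | _ = refl
      ... | true  | true  | true  | _ = ⊥-elim (neighbours-independent (adj⇒Adj cu) (adj⇒Adj cv) uv)
      inside-N () | true  | true  | false | _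
      inside-N () | true  | false | true  | _
      ... | true  | false | false | ()

      -- All neighbours of `u` lie in `N` by `inside-N`, and `u` has the full degree `Δ`, which is
      -- the size of `N`.
      B-N-adjacent : ∀ {u v} → N u ≡ false → N v ≡ true → adj u v ≡ true
      B-N-adjacent {u} {v} u∈B v∈N = 𝟙-injective (trans (sum-rigid adj⊆N tight-u v) (cong 𝟙 v∈N))
        where
        𝟙-injective : ∀ {t} → 𝟙 t ≡ 1 → t ≡ true
        𝟙-injective {true} _ = refl
        adj⊆N : ∀ w → 𝟙 (adj u w) ≤ 𝟙 (N w)
        adj⊆N w with N w in w∈
        ... | true  = 𝟙≤1 (adj u w)
        ... | false rewrite inside-N (trans u∈B (sym w∈)) | inside-N (trans w∈ (sym u∈B)) = ≤-refl
        tight-u : Δ ≤ degree u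
        tight-u with full-degree u
        ... | e rewrite u∈B = ≤-reflexive (sym (trans (sym (*-identityˡ _)) (trans e (*-identityˡ _))))

      across-N : ∀ {u v} → N u ≢ N v → Adj A u v
      across-N {u} {v} u≢v with N u in cu | N v in cv
      ... | true  | true  = ⊥-elim (u≢v refl)
      ... | false | false = ⊥-elim (u≢v refl)
      ... | false | true  = adj⇒Adj (B-N-adjacent cu cv)
      ... | true  | false = adj⇒Adj (trans (Bool.∨-comm (A u v) (A v u)) (B-N-adjacent cv cu))

      tight⇒balanced : Balanced A
      tight⇒balanced with p*q≡turán⇒balanced Δ |B| (subst (λ k → turán k ≤ Δ * |B|) (sym Δ+|B|≡n)
                      (≤-trans tight (≤-trans arcs≤ (≤-trans B-degrees (≤-reflexive (*-comm |B| Δ))))))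
      ... | inj₁ (Δ≡ , B≡) = record
        { part = N ; sizeX = trans Δ≡ (cong ⌈_/2⌉ Δ+|B|≡n) ; sizeY = trans B≡ (cong ⌊_/2⌋ Δ+|B|≡n)
        ; inside = inside-N ; across = across-N }
      -- `part` has to mark the class of size `⌈ n /2⌉`, which here is the complement of `N`.
      ... | inj₂ (Δ≡ , B≡) = record
        { part = not ∘ N ; sizeX = trans B≡ (cong ⌈_/2⌉ Δ+|B|≡n)
        ; sizeY = trans (sum-cong-≗ (λ u → cong 𝟙 (Bool.not-involutive (N u)))) (trans Δ≡ (cong ⌊_/2⌋ Δ+|B|≡n))
        ; inside = inside-N ∘ Bool.not-injective ; across = λ ≢ → across-N (≢ ∘ cong not) }

mantel : {A : Fin n → Fin n → Bool} → Geodetic₂ A → TriangleFree A →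
  arcs A ≤ turán n × (turán n ≤ arcs A → Balanced A)
mantel {zero}  geo tf = z≤n , λ _ → record
  { part = λ () ; sizeX = refl ; sizeY = refl ; inside = λ { {()} } ; across = λ { {()} } }
mantel {suc n} geo tf with argmax (Mantel.degree geo tf)
... | c , max = Mantel.arcs≤turán geo tf c max , Mantel.tight⇒balanced geo tf c max

-- The maximal number of arcs.

triangle? : (A : Fin n → Fin n → Bool) → (∃ λ a → ∃ λ b → ∃ λ c → CyclicTriangle A a b c) ⊎ TriangleFree A
triangle? A with any? (λ a → any? (λ b → any? (λ c → (A a b Bool.≟ true) ×-dec (A b c Bool.≟ true) ×-dec (A c a Bool.≟ true))))
... | yes (a , b , c , ab , bc , ca) = inj₁ (a , b , c , cyclic ab bc ca)
... | no  none = inj₂ λ { {a} {b} {c} (cyclic ab bc ca) → none (a , b , c , ab , bc , ca) }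

-- Either Mantel's bound applies, or deleting a triangle leaves three vertices fewer and
-- `bound-step` absorbs the lost arcs.
arcs≤bound : ∀ n {A : Fin n → Fin n → Bool} → Geodetic₂ A → arcs A ≤ bound n
arcs≤bound = <-rec _ step
  where
  step : ∀ n → (∀ {m} → m < n → {A : Fin m → Fin m → Bool} → Geodetic₂ A → arcs A ≤ bound m) →
    {A : Fin n → Fin n → Bool} → Geodetic₂ A → arcs A ≤ bound n
  step n rec {A} geo with triangle? A
  ... | inj₂ tf = ≤-trans (proj₁ (mantel geo tf)) (turán≤bound n)
  ... | inj₁ (_ , _ , _ , t) with triangle-removal geo t
  ...   | m , n≡3+m , A′ , geo′ , le = begin
    arcs A              ≤⟨ le ⟩
    n + arcs A′         ≤⟨ +-monoʳ-≤ n (rec (subst (m <_) (sym n≡3+m) (m<n+m m (s≤s z≤n))) geo′) ⟩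
    n + bound m         ≡⟨ cong (_+ bound m) n≡3+m ⟩
    3 + m + bound m     ≤⟨ bound-step m ⟩
    bound (3 + m)       ≡⟨ cong bound n≡3+m ⟨
    bound n             ∎
    where open ≤-Reasoning

arcs≤turán : 4 ≤ n → {A : Fin n → Fin n → Bool} → Geodetic₂ A → arcs A ≤ turán n
arcs≤turán 4≤n geo = ≤-trans (arcs≤bound _ geo) (≤-reflexive (bound≡turán 4≤n))

-- As `7 ≤ n`, deleting a triangle leaves at least 4 vertices, so the remainder obeys `arcs≤turán`
-- and the strict step contradicts tightness.
tight⇒balanced : 7 ≤ n → {A : Fin n → Fin n → Bool} → Geodetic₂ A → turán n ≤ arcs A → Balanced A
tight⇒balanced {n} 7≤n {A} geo tight with triangle? A
... | inj₂ tf = proj₂ (mantel geo tf) tight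
... | inj₁ (_ , _ , _ , t) with triangle-removal geo t
...   | m , n≡3+m , A′ , geo′ , le = ⊥-elim (<-irrefl refl (begin-strict
    n + turán m         ≡⟨ cong (_+ turán m) n≡3+m ⟩
    3 + m + turán m     <⟨ turán-step-< 4≤m ⟩
    turán (3 + m)       ≡⟨ cong turán n≡3+m ⟨
    turán n             ≤⟨ tight ⟩
    arcs A              ≤⟨ le ⟩
    n + arcs A′         ≤⟨ +-monoʳ-≤ n (arcs≤turán 4≤m geo′) ⟩
    n + turán m         ∎))
  where
  open ≤-Reasoning
  4≤m : 4 ≤ m
  4≤m = +-cancelˡ-≤ 3 4 m (subst (7 ≤_) n≡3+m 7≤n)

-- Orientations of the balanced complete bipartite graph.

another : (p : Fin n → Bool) → 2 ≤ sum (𝟙 ∘ p) → ∀ v → ∃ λ w → w ≢ v × p w ≡ true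
another p 2≤ v with any? (λ w → ¬? (w ≟ v) ×-dec (p w Bool.≟ true))
... | yes found = found
... | no  none  = ⊥-elim (<⇒≱ 2≤ (count-atMostOne p λ i j pᵢ pⱼ → trans (only pᵢ) (sym (only pⱼ))))
  where
  only : ∀ {i} → p i ≡ true → i ≡ v
  only {i} pᵢ with i ≟ v
  ... | yes i≡v = i≡v
  ... | no  i≢v = ⊥-elim (none (i , i≢v , pᵢ))

module Orientation {n} {A : Fin n → Fin n → Bool} (geo : Geodetic₂ A) (balanced : Balanced A) where
  open Geodetic₂ geo
  open Balanced balanced

  arc-from-Y : ∀ {u v} → part u ≡ false → A u v ≡ true → part v ≡ true
  arc-from-Y {u} {v} u∈Y uv with part v in v∈
  ... | true  = refl
  ... | false = ⊥-elim (true≢false uv (inside (trans u∈Y (sym v∈))))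

  arc-to-Y : ∀ {u v} → part v ≡ false → A u v ≡ true → part u ≡ true
  arc-to-Y {u} {v} v∈Y uv with part u in u∈
  ... | true  = refl
  ... | false = ⊥-elim (true≢false uv (inside (trans u∈ (sym v∈Y))))

  arc-from-X : ∀ {u v} → part u ≡ true → A u v ≡ true → part v ≡ false
  arc-from-X {u} {v} u∈X uv with part v in v∈
  ... | false = refl
  ... | true  = ⊥-elim (true≢false uv (inside (trans u∈X (sym v∈))))

  X-Y-adjacent : ∀ {x y} → part x ≡ true → part y ≡ false → Adj A x y
  X-Y-adjacent x∈X y∈Y = across λ e → true≢false (trans (sym e) x∈X) y∈Y

  -- If `y′` had no arc to `a` or `b`, then `y → a → y′` and `y → b → y′` would be two walks.
  common-out : ∀ {y y′ a b} → part y ≡ false → part y′ ≡ false → a ≢ b → A y a ≡ true → A y b ≡ true →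
    ∃ λ x → A y x ≡ true × A y′ x ≡ true
  common-out {y} {y′} {a} {b} y∈Y y′∈Y a≢b ya yb
    with X-Y-adjacent (arc-from-Y y∈Y ya) y′∈Y | X-Y-adjacent (arc-from-Y y∈Y yb) y′∈Y
  ... | inj₂ y′a | _        = a , ya , y′a
  ... | _        | inj₂ y′b = b , yb , y′b
  ... | inj₁ ay′ | inj₁ by′ = ⊥-elim (a≢b (uniqueMid ya ay′ yb by′))

  common-in : ∀ {y y′ c d} → part y ≡ false → part y′ ≡ false → c ≢ d → A c y ≡ true → A d y ≡ true →
    ∃ λ x → A x y ≡ true × A x y′ ≡ true
  common-in {y} {y′} {c} {d} y∈Y y′∈Y c≢d cy dy
    with X-Y-adjacent (arc-to-Y y∈Y cy) y′∈Y | X-Y-adjacent (arc-to-Y y∈Y dy) y′∈Y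
  ... | inj₁ cy′ | _        = c , cy , cy′
  ... | _        | inj₁ dy′ = d , dy , dy′
  ... | inj₂ y′c | inj₂ y′d = ⊥-elim (c≢d (uniqueMid y′c cy y′d dy))

  Y-out≤1 Y-in≤1 : Set
  Y-out≤1 = ∀ {y a b} → part y ≡ false → A y a ≡ true → A y b ≡ true → a ≡ b
  Y-in≤1  = ∀ {y c d} → part y ≡ false → A c y ≡ true → A d y ≡ true → c ≡ d

  module _ (4≤|X| : 4 ≤ sum (𝟙 ∘ part)) (2≤|Y| : 2 ≤ sum (𝟙 ∘ not ∘ part)) where
    -- Another vertex `y′` of Y shares with `y` an out-neighbour `x` and an in-neighbour `z`, giving
    -- `z → y → x` and `z → y′ → x`.
    not-both : ∀ {y a b c d} → part y ≡ false → a ≢ b → A y a ≡ true → A y b ≡ true →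
      c ≢ d → A c y ≡ true → A d y ≡ true → ⊥
    not-both {y} y∈Y a≢b ya yb c≢d cy dy with another (not ∘ part) 2≤|Y| y
    ... | y′ , y′≢y , ¬X with Bool.not-injective {y = false} ¬X
    ...   | y′∈Y with common-out y∈Y y′∈Y a≢b ya yb | common-in y∈Y y′∈Y c≢d cy dy
    ...     | _ , yx , y′x | _ , zy , zy′ = y′≢y (uniqueMid zy′ y′x zy yx)

    -- Each vertex of X is an in-neighbour of `y`, an out-neighbour of `y′`, or the middle of a walk
    -- from `y` to `y′`. By `not-both` and `uniqueMid` each kind occurs at most once, so `|X| ≤ 3`.
    not-mixed : ∀ {y y′ a b c d} → part y ≡ false → part y′ ≡ false →
      a ≢ b → A y a ≡ true → A y b ≡ true → c ≢ d → A c y′ ≡ true → A d y′ ≡ true → ⊥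
    not-mixed {y} {y′} y∈Y y′∈Y a≢b ya yb c≢d cy′ dy′ = <⇒≱ 4≤|X| |X|≤3
      where
      into-y from-y′ between : Fin n → Bool
      into-y u  = A u y
      from-y′ u = A y′ u
      between u = A y u ∧ A u y′
      ∧-true : ∀ {s t} → s ∧ t ≡ true → s ≡ true × t ≡ true
      ∧-true {true} {true} _ = refl , refl
      into-y≤1 : sum (𝟙 ∘ into-y) ≤ 1
      into-y≤1 = count-atMostOne into-y unique
        where
        unique : ∀ i j → A i y ≡ true → A j y ≡ true → i ≡ j
        unique i j iy jy with i ≟ j
        ... | yes i≡j = i≡j
        ... | no  i≢j = ⊥-elim (not-both y∈Y a≢b ya yb i≢j iy jy)
      from-y′≤1 : sum (𝟙 ∘ from-y′) ≤ 1
      from-y′≤1 = count-atMostOne from-y′ unique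
        where
        unique : ∀ i j → A y′ i ≡ true → A y′ j ≡ true → i ≡ j
        unique i j y′i y′j with i ≟ j
        ... | yes i≡j = i≡j
        ... | no  i≢j = ⊥-elim (not-both y′∈Y i≢j y′i y′j c≢d cy′ dy′)
      between≤1 : sum (𝟙 ∘ between) ≤ 1
      between≤1 = count-atMostOne between unique
        where
        unique : ∀ i j → between i ≡ true → between j ≡ true → i ≡ j
        unique i j pᵢ pⱼ with ∧-true pᵢ | ∧-true pⱼ
        ... | yi , iy′ | yj , jy′ = uniqueMid yi iy′ yj jy′
      cover : ∀ u → 𝟙 (part u) ≤ 𝟙 (into-y u) + (𝟙 (from-y′ u) + 𝟙 (between u))
      cover u with part u in u∈
      ... | false = z≤n
      ... | true with X-Y-adjacent u∈ y∈Y | X-Y-adjacent u∈ y′∈Y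
      ...   | inj₁ uy | _        rewrite uy = s≤s z≤n
      ...   | inj₂ yu | inj₂ y′u rewrite y′u = m≤n⇒m≤o+n (𝟙 (into-y u)) (s≤s z≤n)
      ...   | inj₂ yu | inj₁ uy′ rewrite yu | uy′ =
        m≤n⇒m≤o+n (𝟙 (into-y u)) (m≤n⇒m≤o+n (𝟙 (from-y′ u)) ≤-refl)
      |X|≤3 : sum (𝟙 ∘ part) ≤ 3
      |X|≤3 = begin
        sum (𝟙 ∘ part)
          ≤⟨ sum-mono cover ⟩
        ∑[ u < n ] (𝟙 (into-y u) + (𝟙 (from-y′ u) + 𝟙 (between u)))
          ≡⟨ ∑-distrib-+ (𝟙 ∘ into-y) _ ⟩
        sum (𝟙 ∘ into-y) + ∑[ u < n ] (𝟙 (from-y′ u) + 𝟙 (between u))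
          ≡⟨ cong (sum (𝟙 ∘ into-y) +_) (∑-distrib-+ (𝟙 ∘ from-y′) _) ⟩
        sum (𝟙 ∘ into-y) + (sum (𝟙 ∘ from-y′) + sum (𝟙 ∘ between))
          ≤⟨ +-mono-≤ into-y≤1 (+-mono-≤ from-y′≤1 between≤1) ⟩
        3 ∎
        where open ≤-Reasoning

    out≤1⊎in≤1 : Y-out≤1 ⊎ Y-in≤1
    out≤1⊎in≤1 with any? (λ y → any? (λ a → any? (λ b →
      (part y Bool.≟ false) ×-dec ¬? (a ≟ b) ×-dec (A y a Bool.≟ true) ×-dec (A y b Bool.≟ true))))
    ... | yes (y , a , b , y∈Y , a≢b , ya , yb) = inj₂ unique
      where
      unique : Y-in≤1
      unique {y′} {c} {d} y′∈Y cy′ dy′ with c ≟ d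
      ... | yes c≡d = c≡d
      ... | no  c≢d = ⊥-elim (not-mixed y∈Y y′∈Y a≢b ya yb c≢d cy′ dy′)
    ... | no none = inj₁ unique
      where
      unique : Y-out≤1
      unique {y} {a} {b} y∈Y ya yb with a ≟ b
      ... | yes a≡b = a≡b
      ... | no  a≢b = ⊥-elim (none (y , a , b , y∈Y , a≢b , ya , yb))

    other-X : ∀ v → ∃ λ x → x ≢ v × part x ≡ true
    other-X = another part (≤-trans (s≤s (s≤s z≤n)) 4≤|X|)

    -- The only arcs leaving `u` and `u′` end in `v`, so any other `x` in X has arcs to both, and
    -- `x → u → v` meets `x → u′ → v`.
    out≤1⇒in≤1 : Y-out≤1 → ∀ {u u′ v} → part u ≡ false → part u′ ≡ false → A u v ≡ true → A u′ v ≡ true → u ≡ u′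
    out≤1⇒in≤1 unique {v = v} u∈Y u′∈Y uv u′v with other-X v
    ... | x , x≢v , x∈X with X-Y-adjacent x∈X u∈Y | X-Y-adjacent x∈X u′∈Y
    ...   | inj₁ xu | inj₁ xu′ = uniqueMid xu uv xu′ u′v
    ...   | inj₂ ux | _        = ⊥-elim (x≢v (unique u∈Y ux uv))
    ...   | _       | inj₂ u′x = ⊥-elim (x≢v (unique u′∈Y u′x u′v))

    -- The arcs from `u` are the only ones entering `v` and `v′`, so another `x` in X receives arcs
    -- from both, and `u → v → x` meets `u → v′ → x`.
    in≤1⇒out≤1 : Y-in≤1 → ∀ {u v v′} → part u ≡ true → A u v ≡ true → A u v′ ≡ true → v ≡ v′
    in≤1⇒out≤1 unique {u} u∈X uv uv′ with other-X u
    ... | x , x≢u , x∈X with X-Y-adjacent x∈X (arc-from-X u∈X uv) | X-Y-adjacent x∈X (arc-from-X u∈X uv′)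
    ...   | inj₂ vx | inj₂ v′x = uniqueMid uv vx uv′ v′x
    ...   | inj₁ xv | _        = ⊥-elim (x≢u (unique (arc-from-X u∈X uv) xv uv))
    ...   | _       | inj₁ xv′ = ⊥-elim (x≢u (unique (arc-from-X u∈X uv′) xv′ uv′))

balanced⇒matchingReversed : 7 ≤ n → (G : Digraph n) → Geodetic₂ (arc G) → Balanced (arc G) → MatchingReversedBipartite G
balanced⇒matchingReversed {n} 7≤n G geo bal = case (out≤1⊎in≤1 4≤|X| 2≤|Y|)
  where
  open Geodetic₂ geo
  open Balanced bal renaming (inside to inside′; across to across′)
  open Orientation geo bal
  4≤|X| : 4 ≤ sum (𝟙 ∘ part)
  -- `⌈ 7 /2⌉` is 4, just enough to contradict `|X| ≤ 3` in `not-mixed`.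
  4≤|X| = subst (4 ≤_) (sym sizeX) (⌈n/2⌉-mono 7≤n)
  2≤|Y| : 2 ≤ sum (𝟙 ∘ not ∘ part)
  2≤|Y| = subst (2 ≤_) (sym sizeY) (≤-trans (n≤1+n 2) (⌊n/2⌋-mono 7≤n))
  exactly-one : ∀ u v → part u ≢ part v →
    (arc G u v ≡ true × arc G v u ≡ false) ⊎ (arc G u v ≡ false × arc G v u ≡ true)
  exactly-one u v u≢v with across′ u≢v
  ... | inj₁ uv = inj₁ (uv , ¬true⇒false (oriented uv))
  ... | inj₂ vu = inj₂ (¬true⇒false (oriented vu) , vu)
  build : ∀ dir → (∀ u v u′ v′ → arc G u v ≡ true → arc G u′ v′ ≡ true → part u ≢ dir → part u′ ≢ dir →
    (u ≡ u′ → v ≡ v′) × (v ≡ v′ → u ≡ u′)) → MatchingReversedBipartite G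
  build dir matching = record
    { part = part ; sizeX = trans (count≡sum part) sizeX ; sizeY = trans (count≡sum (not ∘ part)) sizeY
    ; inside = λ u v → inside′ ; across = exactly-one ; dir = dir ; matching = matching }
  case : Y-out≤1 ⊎ Y-in≤1 → MatchingReversedBipartite G
  -- The arcs leaving Y are the exceptional ones here; in the other case they are those leaving X.
  case (inj₁ out) = build true λ u v u′ v′ uv u′v′ u∈Y u′∈Y →
    (λ { refl → out (Bool.¬-not u∈Y) uv u′v′ }) ,
    (λ { refl → out≤1⇒in≤1 4≤|X| 2≤|Y| out (Bool.¬-not u∈Y) (Bool.¬-not u′∈Y) uv u′v′ })
  case (inj₂ in′) = build false λ u v u′ v′ uv u′v′ u∈X u′∈X →
    (λ { refl → in≤1⇒out≤1 4≤|X| 2≤|Y| in′ (Bool.¬-not u∈X) uv u′v′ }) ,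
    (λ { refl → in′ (arc-from-X (Bool.¬-not u∈X) uv) uv u′v′ })

-- Standard digraphs with a reversed matching.

record IsMatching {V W : Set} (M : V → W → Bool) : Set where
  field
    functional : ∀ {x y y′} → M x y ≡ true → M x y′ ≡ true → y ≡ y′
    injective  : ∀ {x x′ y} → M x y ≡ true → M x′ y ≡ true → x ≡ x′
open IsMatching

reversing : {V W : Set} → (V → W → Bool) → V ⊎ W → V ⊎ W → Bool
reversing M (inj₁ x) (inj₁ _) = false
reversing M (inj₁ x) (inj₂ y) = not (M x y)
reversing M (inj₂ y) (inj₁ x) = M x y
reversing M (inj₂ y) (inj₂ _) = false

reversing-loopless : {V W : Set} (M : V → W → Bool) → ∀ s → reversing M s s ≡ false
reversing-loopless M (inj₁ x) = refl
reversing-loopless M (inj₂ y) = refl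

-- A walk of length 2 returns to its starting side, and exactly one of its two steps is a reversed
-- arc. The matching property at the fixed end of that arc determines the middle vertex.
reversing-geodetic : {V W : Set} {M : V → W → Bool} → IsMatching M → Geodetic₂ (reversing M)
reversing-geodetic {M = M} mat = record
  { oriented = λ {u} {v} → asym u v
  ; noShortcut = λ {u} {v} {w} → transitive-free u v w
  ; uniqueMid = λ {u} {v} {v′} {w} → middle u v v′ w }
  where
  asym : ∀ u v → reversing M u v ≡ true → reversing M v u ≡ true → ⊥
  asym (inj₁ x) (inj₂ y) uv vu rewrite vu with () ← uv
  asym (inj₂ y) (inj₁ x) uv vu rewrite uv with () ← vu
  transitive-free : ∀ u v w → reversing M u v ≡ true → reversing M v w ≡ true → reversing M u w ≡ true → ⊥
  transitive-free (inj₁ _) (inj₁ _) _ () _ _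
  transitive-free (inj₂ _) (inj₂ _) _ () _ _
  transitive-free _ (inj₁ _) (inj₁ _) _ () _
  transitive-free _ (inj₂ _) (inj₂ _) _ () _
  transitive-free (inj₁ _) _ (inj₁ _) _ _ ()
  transitive-free (inj₂ _) _ (inj₂ _) _ _ ()
  middle : ∀ u v v′ w → reversing M u v ≡ true → reversing M v w ≡ true →
    reversing M u v′ ≡ true → reversing M v′ w ≡ true → v ≡ v′
  middle (inj₁ _) (inj₂ y) (inj₂ y′) (inj₁ x) _ yx _ y′x = cong inj₂ (functional mat yx y′x)
  middle (inj₂ y) (inj₁ x) (inj₁ x′) (inj₂ _) yx _ yx′ _ = cong inj₁ (injective mat yx yx′)

-- The matching pairs `i` with `i` for `i < k`; the recursion peels off the first vertex of both
-- parts at once, as `matching-normalForm` does with a matched pair.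
ladder : ℕ → Fin p → Fin q → Bool
ladder zero    _       _       = false
ladder (suc k) zero    zero    = true
ladder (suc k) zero    (suc _) = false
ladder (suc k) (suc _) zero    = false
ladder (suc k) (suc i) (suc j) = ladder k i j

ladder-functional : ∀ k {x : Fin p} {y y′ : Fin q} → ladder k x y ≡ true → ladder k x y′ ≡ true → y ≡ y′
ladder-functional (suc k) {zero}  {zero}  {zero}   _ _ = refl
ladder-functional (suc k) {suc x} {suc y} {suc y′} e e′ = cong suc (ladder-functional k {x} e e′)

ladder-injective : ∀ k {x x′ : Fin p} {y : Fin q} → ladder k x y ≡ true → ladder k x′ y ≡ true → x ≡ x′
ladder-injective (suc k) {zero}  {zero}   {zero}  _ _ = refl
ladder-injective (suc k) {suc x} {suc x′} {suc y} e e′ = cong suc (ladder-injective k {x} {x′} {y} e e′)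

ladder-matching : ∀ k → IsMatching (ladder {p} {q} k)
ladder-matching k = record
  { functional = λ {x} → ladder-functional k {x} ; injective = λ {x} {x′} → ladder-injective k {x} {x′} }

ladder-count : k ≤ p → k ≤ q → ∑[ i < p ] ∑[ j < q ] 𝟙 (ladder k i j) ≡ k
ladder-count {p = p} {q} z≤n z≤n = trans (sum-cong-≗ {p} (λ _ → sum-zero q)) (sum-zero p)
ladder-count {q = suc q} (s≤s k≤p) (s≤s k≤q) = cong suc (cong₂ _+_ (sum-zero q) (ladder-count k≤p k≤q))

-- The equation is irrelevant, so different proofs of it give definitionally equal digraphs. Keeping
-- `n` separate from `p + q` puts both orders of the parts on the same `Fin n`.
module _ (p q : ℕ) .(n≡p+q : n ≡ p + q) where
  side : Fin n ↔ (Fin p ⊎ Fin q)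
  side = +↔⊎ ↔-∘ cast-id n≡p+q

  standard : ℕ → Digraph n
  standard k = record
    { arc = λ u v → reversing (ladder k) (Inverse.to side u) (Inverse.to side v)
    ; loopless = λ v → reversing-loopless (ladder k) (Inverse.to side v) }

  standard-geodetic : ∀ k → Geodetic 2 (standard k)
  standard-geodetic k = ⇒geodetic (standard k)
    (geodetic-restrict (Inverse.to side) (Injection.injective (↔⇒↣ side)) (reversing-geodetic (ladder-matching k)))

-- Outdegrees as isomorphism invariants.

sum-splitAt : ∀ p {q} (f : Fin p ⊎ Fin q → ℕ) → sum (f ∘ splitAt p) ≡ sum (f ∘ inj₁) + sum (f ∘ inj₂)
sum-splitAt zero    f = refl
sum-splitAt (suc p) f = trans (cong (f (inj₁ zero) +_) (sum-splitAt p (f ∘ Sum.map suc id)))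
  (sym (+-assoc (f (inj₁ zero)) _ _))

sum-side : ∀ p q (e : n ≡ p + q) (f : Fin p ⊎ Fin q → ℕ) →
  sum (f ∘ Inverse.to (side p q e)) ≡ sum (f ∘ inj₁) + sum (f ∘ inj₂)
sum-side p q refl f = trans (sum-cong-≗ (λ i → cong (f ∘ splitAt p) (cast-is-id refl i))) (sum-splitAt p f)

outdegree : (Fin n → Fin n → Bool) → Fin n → ℕ
outdegree A u = sum (𝟙 ∘ A u)

module _ (p q : ℕ) (e : n ≡ p + q) (k : ℕ) where
  private
    S : Digraph n
    S = standard p q e k
    out : Fin p ⊎ Fin q → ℕ
    out (inj₁ x) = ∑[ y < q ] 𝟙 (not (ladder k x y))
    out (inj₂ y) = ∑[ x < p ] 𝟙 (ladder k x y)

  standard-outdegree : ∀ s → ∑[ v < n ] 𝟙 (reversing (ladder k) s (Inverse.to (side p q e) v)) ≡ out s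
  standard-outdegree (inj₁ x) = trans (sum-side p q e (𝟙 ∘ reversing (ladder k) (inj₁ x))) (cong (_+ out (inj₁ x)) (sum-zero p))
  standard-outdegree (inj₂ y) = trans (sum-side p q e (𝟙 ∘ reversing (ladder k) (inj₂ y)))
    (trans (cong (out (inj₂ y) +_) (sum-zero q)) (+-identityʳ _))

  sum-outdegree : (φ : ℕ → ℕ) → ∑[ u < n ] φ (outdegree (arc S) u) ≡ sum (φ ∘ out ∘ inj₁) + sum (φ ∘ out ∘ inj₂)
  sum-outdegree φ = trans (sum-cong-≗ (cong φ ∘ standard-outdegree ∘ Inverse.to (side p q e))) (sum-side p q e (φ ∘ out))

  out-split : ∀ x → out (inj₁ x) + ∑[ y < q ] 𝟙 (ladder k x y) ≡ q
  out-split x = trans (sym (∑-distrib-+ {q} (λ y → 𝟙 (not (ladder k x y))) _))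
    (trans (sum-cong-≗ {q} (λ y → complement (ladder k x y))) (trans (sum-const q 1) (*-identityʳ q)))
    where
    complement : ∀ t → 𝟙 (not t) + 𝟙 t ≡ 1
    complement true  = refl
    complement false = refl

  -- Each pair of the `p` by `q` grid carries one arc, counted at its left end or, if reversed, at
  -- its right end; exchanging the sums collects both counts in the same row.
  size-standard : size S ≡ p * q
  size-standard = begin
    size S
      ≡⟨ size≡arcs S ⟩
    sum (outdegree (arc S))
      ≡⟨ sum-outdegree id ⟩
    sum (out ∘ inj₁) + sum (out ∘ inj₂)
      ≡⟨ cong (sum (out ∘ inj₁) +_) (∑-comm {q} {p} (λ y x → 𝟙 (ladder k x y))) ⟩
    sum (out ∘ inj₁) + ∑[ x < p ] ∑[ y < q ] 𝟙 (ladder k x y)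
      ≡⟨ ∑-distrib-+ (out ∘ inj₁) _ ⟨
    ∑[ x < p ] (out (inj₁ x) + ∑[ y < q ] 𝟙 (ladder k x y))
      ≡⟨ sum-cong-≗ out-split ⟩
    ∑[ x < p ] q
      ≡⟨ sum-const p q ⟩
    p * q ∎
    where open ≡-Reasoning

  -- A left vertex loses at most one of its `q` outgoing arcs to the matching.
  out-inj₁≥ : 3 ≤ q → ∀ x → 2 ≤ out (inj₁ x)
  out-inj₁≥ 3≤q x = +-cancelʳ-≤ 1 2 _ (≤-trans 3≤q (≤-trans (≤-reflexive (sym (out-split x)))
    (+-monoʳ-≤ (out (inj₁ x)) (count-atMostOne {q} (ladder k x) λ _ _ → ladder-functional k {x}))))

  out-inj₂≤ : ∀ y → out (inj₂ y) ≤ 1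
  out-inj₂≤ y = count-atMostOne {p} (λ x → ladder k x y) λ x x′ → ladder-injective k {x} {x′}

≥2? =1? : ℕ → ℕ
≥2? (suc (suc _)) = 1
≥2? _             = 0
=1? 1 = 1
=1? _ = 0

standard-≥2 : ∀ p q (e : n ≡ p + q) → 3 ≤ q → ∑[ u < n ] ≥2? (outdegree (arc (standard p q e k)) u) ≡ p
standard-≥2 {k = k} p q e 3≤q = trans (sum-outdegree p q e k ≥2?)
  (trans (cong₂ _+_ (trans (sum-cong-≗ (λ x → large (out-inj₁≥ p q e k 3≤q x))) (trans (sum-const p 1) (*-identityʳ p)))
                    (trans (sum-cong-≗ (λ y → small (out-inj₂≤ p q e k y))) (sum-zero q)))
         (+-identityʳ p))
  where
  large : ∀ {d} → 2 ≤ d → ≥2? d ≡ 1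
  large (s≤s (s≤s _)) = refl
  small : ∀ {d} → d ≤ 1 → ≥2? d ≡ 0
  small z≤n       = refl
  small (s≤s z≤n) = refl

-- Left vertices have outdegree at least 2. Right ones have outdegree 0 or 1, so counting the ones
-- amounts to summing outdegrees, that is, counting the pairs of the ladder.
standard-=1 : ∀ p q (e : n ≡ p + q) → 3 ≤ q → k ≤ p → k ≤ q → ∑[ u < n ] =1? (outdegree (arc (standard p q e k)) u) ≡ k
standard-=1 {k = k} p q e 3≤q k≤p k≤q = trans (sum-outdegree p q e k =1?)
  (cong₂ _+_ (trans (sum-cong-≗ (λ x → large (out-inj₁≥ p q e k 3≤q x))) (sum-zero p))
             (trans (sum-cong-≗ (λ y → small (out-inj₂≤ p q e k y)))
                    (trans (∑-comm {q} {p} (λ y x → 𝟙 (ladder k x y))) (ladder-count k≤p k≤q))))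
  where
  large : ∀ {d} → 2 ≤ d → =1? d ≡ 0
  large (s≤s (s≤s _)) = refl
  small : ∀ {d} → d ≤ 1 → =1? d ≡ d
  small z≤n       = refl
  small (s≤s z≤n) = refl

-- The permutation reindexes the sum over `u` and, inside it, each outdegree.
≅-outdegree : (G H : Digraph n) → G ≅ H → (φ : ℕ → ℕ) →
  ∑[ u < n ] φ (outdegree (arc G) u) ≡ ∑[ u < n ] φ (outdegree (arc H) u)
≅-outdegree G H (σ , iso) φ = sym (trans (sum-permute (φ ∘ outdegree (arc H)) σ)
  (sum-cong-≗ λ u → cong φ (trans (sum-permute (𝟙 ∘ arc H (σ ⟨$⟩ʳ u)) σ)
    (sum-cong-≗ λ v → cong 𝟙 (sym (iso u v))))))

standard-≅-sources : ∀ {p q p′ q′ k k′} (e : n ≡ p + q) (e′ : n ≡ p′ + q′) → 3 ≤ q → 3 ≤ q′ →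
  standard p q e k ≅ standard p′ q′ e′ k′ → p ≡ p′
standard-≅-sources {p = p} {q} {p′} {q′} {k} {k′} e e′ 3≤q 3≤q′ iso = begin
  p                                                              ≡⟨ standard-≥2 {k = k} p q e 3≤q ⟨
  sum (≥2? ∘ outdegree (arc (standard p q e k)))                 ≡⟨ ≅-outdegree (standard p q e k) (standard p′ q′ e′ k′) iso ≥2? ⟩
  sum (≥2? ∘ outdegree (arc (standard p′ q′ e′ k′)))             ≡⟨ standard-≥2 {k = k′} p′ q′ e′ 3≤q′ ⟩
  p′                                                             ∎
  where open ≡-Reasoning

standard-≅-reversed : ∀ {p q k k′} (e : n ≡ p + q) → 3 ≤ q → k ≤ p → k ≤ q → k′ ≤ p → k′ ≤ q →
  standard p q e k ≅ standard p q e k′ → k ≡ k′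
standard-≅-reversed {p = p} {q} {k} {k′} e 3≤q k≤p k≤q k′≤p k′≤q iso = begin
  k                                                              ≡⟨ standard-=1 p q e 3≤q k≤p k≤q ⟨
  sum (=1? ∘ outdegree (arc (standard p q e k)))                 ≡⟨ ≅-outdegree (standard p q e k) (standard p q e k′) iso =1? ⟩
  sum (=1? ∘ outdegree (arc (standard p q e k′)))                ≡⟨ standard-=1 p q e 3≤q k′≤p k′≤q ⟩
  k′                                                             ∎
  where open ≡-Reasoning

-- Normal form of a matching.

insert-at : ∀ i j (π : Permutation m n) → insert i j π ⟨$⟩ʳ i ≡ j
insert-at i j π with i ≟ i
... | yes _   = refl
... | no  i≢i = ⊥-elim (i≢i refl)

punchIn-cases : ∀ (i j : Fin (suc n)) → j ≡ i ⊎ ∃ λ j′ → j ≡ punchIn i j′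
punchIn-cases i j with i ≟ j
... | yes i≡j = inj₁ (sym i≡j)
... | no  i≢j = inj₂ (punchOut i≢j , sym (punchIn-punchOut i≢j))

-- A matched pair is sent to `zero` on both sides and the rest is treated recursively; no other pair
-- can involve its two vertices.
matching-normalForm : ∀ {p q} {M : Fin p → Fin q → Bool} → IsMatching M →
  ∃ λ k → k ≤ p × k ≤ q × Σ (Permutation′ p) λ π → Σ (Permutation′ q) λ ρ →
  ∀ x y → M x y ≡ ladder k (π ⟨$⟩ʳ x) (ρ ⟨$⟩ʳ y)
matching-normalForm {p} {q} {M} mat with any? (λ x → any? (λ y → M x y Bool.≟ true))
... | no none = 0 , z≤n , z≤n , Perm.id , Perm.id , λ x y → ¬true⇒false λ xy → none (x , y , xy)
matching-normalForm {suc p} {suc q} {M} mat | yes (x₀ , y₀ , x₀y₀)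
  with matching-normalForm {p} {q} {λ i j → M (punchIn x₀ i) (punchIn y₀ j)} record
    { functional = λ e e′ → punchIn-injective y₀ _ _ (functional mat e e′)
    ; injective  = λ e e′ → punchIn-injective x₀ _ _ (injective mat e e′) }
... | k , k≤p , k≤q , π , ρ , M≡ladder =
  suc k , s≤s k≤p , s≤s k≤q , π⁺ , ρ⁺ , correct
  where
  π⁺ : Permutation′ (suc p)
  π⁺ = insert x₀ zero π
  ρ⁺ : Permutation′ (suc q)
  ρ⁺ = insert y₀ zero ρ
  correct : ∀ x y → M x y ≡ ladder (suc k) (π⁺ ⟨$⟩ʳ x) (ρ⁺ ⟨$⟩ʳ y)
  correct x y with punchIn-cases x₀ x | punchIn-cases y₀ y
  ... | inj₁ refl | inj₁ refl rewrite insert-at x₀ zero π | insert-at y₀ zero ρ = x₀y₀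
  ... | inj₁ refl | inj₂ (j , refl) rewrite insert-at x₀ zero π | insert-punchIn y₀ zero ρ j =
    ¬true⇒false λ x₀y → punchInᵢ≢i y₀ j (functional mat x₀y x₀y₀)
  ... | inj₂ (i , refl) | inj₁ refl rewrite insert-punchIn x₀ zero π i | insert-at y₀ zero ρ =
    ¬true⇒false λ xy₀ → punchInᵢ≢i x₀ i (injective mat xy₀ x₀y₀)
  ... | inj₂ (i , refl) | inj₂ (j , refl) rewrite insert-punchIn x₀ zero π i | insert-punchIn y₀ zero ρ j =
    M≡ladder i j

-- Isomorphism with a standard digraph.

isLeft : {V W : Set} → V ⊎ W → Bool
isLeft (inj₁ _) = true
isLeft (inj₂ _) = false

isLeft-map : {V W V′ W′ : Set} {f : V → V′} {g : W → W′} (s : V ⊎ W) → isLeft (Sum.map f g s) ≡ isLeft s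
isLeft-map (inj₁ _) = refl
isLeft-map (inj₂ _) = refl

extendˡ : Fin n ↔ (Fin p ⊎ Fin q) → Fin (suc n) ↔ (Fin (suc p) ⊎ Fin q)
extendˡ {n} {p} {q} e = mk↔ₛ′ to′ from′ to∘from from∘to
  where
  open Inverse e
  to′ : Fin (suc n) → Fin (suc p) ⊎ Fin q
  to′ zero    = inj₁ zero
  to′ (suc i) = Sum.map suc id (to i)
  from′ : Fin (suc p) ⊎ Fin q → Fin (suc n)
  from′ (inj₁ zero)    = zero
  from′ (inj₁ (suc x)) = suc (from (inj₁ x))
  from′ (inj₂ y)       = suc (from (inj₂ y))
  to∘from : ∀ s → to′ (from′ s) ≡ s
  to∘from (inj₁ zero)    = refl
  to∘from (inj₁ (suc x)) = cong (Sum.map suc id) (strictlyInverseˡ (inj₁ x))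
  to∘from (inj₂ y)       = cong (Sum.map suc id) (strictlyInverseˡ (inj₂ y))
  from∘map : ∀ s → from′ (Sum.map suc id s) ≡ suc (from s)
  from∘map (inj₁ x) = refl
  from∘map (inj₂ y) = refl
  from∘to : ∀ i → from′ (to′ i) ≡ i
  from∘to zero    = refl
  from∘to (suc i) = trans (from∘map (to i)) (cong suc (strictlyInverseʳ i))

extendʳ : Fin n ↔ (Fin p ⊎ Fin q) → Fin (suc n) ↔ (Fin p ⊎ Fin (suc q))
extendʳ {n} {p} {q} e = mk↔ₛ′ to′ from′ to∘from from∘to
  where
  open Inverse e
  to′ : Fin (suc n) → Fin p ⊎ Fin (suc q)
  to′ zero    = inj₂ zero
  to′ (suc i) = Sum.map id suc (to i)
  from′ : Fin p ⊎ Fin (suc q) → Fin (suc n)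
  from′ (inj₂ zero)    = zero
  from′ (inj₂ (suc y)) = suc (from (inj₂ y))
  from′ (inj₁ x)       = suc (from (inj₁ x))
  to∘from : ∀ s → to′ (from′ s) ≡ s
  to∘from (inj₂ zero)    = refl
  to∘from (inj₂ (suc y)) = cong (Sum.map id suc) (strictlyInverseˡ (inj₂ y))
  to∘from (inj₁ x)       = cong (Sum.map id suc) (strictlyInverseˡ (inj₁ x))
  from∘map : ∀ s → from′ (Sum.map id suc s) ≡ suc (from s)
  from∘map (inj₁ x) = refl
  from∘map (inj₂ y) = refl
  from∘to : ∀ i → from′ (to′ i) ≡ i
  from∘to zero    = refl
  from∘to (suc i) = trans (from∘map (to i)) (cong suc (strictlyInverseʳ i))

partition : (c : Fin n → Bool) → Σ (Fin n ↔ (Fin (sum (𝟙 ∘ c)) ⊎ Fin (sum (𝟙 ∘ not ∘ c)))) λ e →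
  ∀ u → isLeft (Inverse.to e u) ≡ c u
partition {zero}  c = mk↔ₛ′ (λ ()) (λ { (inj₁ ()) ; (inj₂ ()) }) (λ { (inj₁ ()) ; (inj₂ ()) }) (λ ()) , λ ()
partition {suc n} c with c zero in c₀ | partition (c ∘ suc)
... | true  | e , sides = extendˡ e , λ { zero → sym c₀ ; (suc i) → trans (isLeft-map (Inverse.to e i)) (sides i) }
... | false | e , sides = extendʳ e , λ { zero → sym c₀ ; (suc i) → trans (isLeft-map (Inverse.to e i)) (sides i) }

-- The reversed arcs, read as a relation `M` between the two sides of `src`, form a matching, and
-- its normal form fixes the relabelling. As `M x y` is an arc from `y` to `x`, `functional` comes
-- from equal heads and `injective` from equal tails.
≅-standard : (D : Digraph n) (src : Fin n → Bool) → sum (𝟙 ∘ src) ≡ p → sum (𝟙 ∘ not ∘ src) ≡ q →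
  (∀ {u v} → src u ≡ src v → arc D u v ≡ false) →
  (∀ {u v} → src u ≡ true → src v ≡ false → arc D u v ≡ not (arc D v u)) →
  (∀ {u v u′ v′} → src u ≡ false → src u′ ≡ false → arc D u v ≡ true → arc D u′ v′ ≡ true →
    (u ≡ u′ → v ≡ v′) × (v ≡ v′ → u ≡ u′)) →
  (e : n ≡ p + q) → ∃ λ k → k ≤ p × k ≤ q × (D ≅ standard p q e k)
≅-standard {n} D src refl refl inside across matching e with partition src
... | P , sides = relabel (matching-normalForm M-matching)
  where
  |X| |Y| : ℕ
  |X| = sum (𝟙 ∘ src)
  |Y| = sum (𝟙 ∘ not ∘ src)
  open Inverse P using (to; from; strictlyInverseˡ; strictlyInverseʳ)
  M : Fin |X| → Fin |Y| → Bool
  M x y = arc D (from (inj₂ y)) (from (inj₁ x))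
  from-injective : ∀ {s t} → from s ≡ from t → s ≡ t
  from-injective {s} {t} eq = trans (sym (strictlyInverseˡ s)) (trans (cong to eq) (strictlyInverseˡ t))
  src-from : ∀ s → src (from s) ≡ isLeft s
  src-from s = trans (sym (sides (from s))) (cong isLeft (strictlyInverseˡ s))
  M-matching : IsMatching M
  M-matching = record
    { functional = λ xy xy′ → inj₂-injective (from-injective (proj₂ (matching (src-from _) (src-from _) xy xy′) refl))
    ; injective  = λ xy x′y → inj₁-injective (from-injective (proj₁ (matching (src-from _) (src-from _) xy x′y) refl)) }
  relabel : (∃ λ k → k ≤ |X| × k ≤ |Y| × Σ (Permutation′ |X|) λ π → Σ (Permutation′ |Y|) λ ρ →
      ∀ x y → M x y ≡ ladder k (π ⟨$⟩ʳ x) (ρ ⟨$⟩ʳ y)) →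
    ∃ λ k → k ≤ |X| × k ≤ |Y| × (D ≅ standard |X| |Y| e k)
  -- The vertex permutation splits by `src`, permutes each part by `π` or `ρ`, and rejoins the
  -- parts.
  relabel (k , k≤p , k≤q , π , ρ , M≡ladder) = k , k≤p , k≤q , ↔-sym (side |X| |Y| e) ↔-∘ ((π ⊎-↔ ρ) ↔-∘ P) , iso
    where
    arc-from : ∀ s t → arc D (from s) (from t) ≡
      reversing (ladder k) (Sum.map (π ⟨$⟩ʳ_) (ρ ⟨$⟩ʳ_) s) (Sum.map (π ⟨$⟩ʳ_) (ρ ⟨$⟩ʳ_) t)
    arc-from (inj₁ x) (inj₁ x′) = inside (trans (src-from _) (sym (src-from _)))
    arc-from (inj₁ x) (inj₂ y)  = trans (across (src-from _) (src-from _)) (cong not (M≡ladder x y))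
    arc-from (inj₂ y) (inj₁ x)  = M≡ladder x y
    arc-from (inj₂ y) (inj₂ y′) = inside (trans (src-from _) (sym (src-from _)))
    place : Fin n → Fin |X| ⊎ Fin |Y|
    place u = Sum.map (π ⟨$⟩ʳ_) (ρ ⟨$⟩ʳ_) (to u)
    iso : ∀ u v → arc D u v ≡ arc (standard |X| |Y| e k) (Inverse.from (side |X| |Y| e) (place u)) (Inverse.from (side |X| |Y| e) (place v))
    iso u v = begin
      arc D u v
        ≡⟨ cong₂ (arc D) (strictlyInverseʳ u) (strictlyInverseʳ v) ⟨
      arc D (from (to u)) (from (to v))
        ≡⟨ arc-from (to u) (to v) ⟩
      reversing (ladder k) (place u) (place v)
        ≡⟨ cong₂ (reversing (ladder k)) (Inverse.strictlyInverseˡ (side |X| |Y| e) (place u)) (Inverse.strictlyInverseˡ (side |X| |Y| e) (place v)) ⟨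
      arc (standard |X| |Y| e k) (Inverse.from (side |X| |Y| e) (place u)) (Inverse.from (side |X| |Y| e) (place v)) ∎
      where open ≡-Reasoning

-- Extremal digraphs and their isomorphism classes.

module _ {n} (7≤n : 7 ≤ n) where
  private
    c f : ℕ
    c = ⌈ n /2⌉
    f = ⌊ n /2⌋
    f≤c : f ≤ c
    f≤c = ⌊n/2⌋≤⌈n/2⌉ n
    3≤f : 3 ≤ f
    3≤f = ⌊n/2⌋-mono 7≤n
    3≤c : 3 ≤ c
    3≤c = ≤-trans 3≤f f≤c
    n≡f+c : n ≡ f + c
    n≡f+c = sym (⌊n/2⌋+⌈n/2⌉≡n n)
    n≡c+f : n ≡ c + f
    n≡c+f = trans n≡f+c (+-comm f c)

  size≤turán : (H : Digraph n) → Geodetic 2 H → size H ≤ turán n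
  size≤turán H geo = subst (_≤ turán n) (sym (size≡arcs H))
    (arcs≤turán (≤-trans (s≤s (s≤s (s≤s (s≤s z≤n)))) 7≤n) (geodetic⇒ H geo))

  standard-extremal : ∀ p q (e : n ≡ p + q) → p * q ≡ turán n → ∀ k → Extremal2 (standard p q e k)
  standard-extremal p q e pq k = standard-geodetic p q e k , λ H geo →
    ≤-trans (size≤turán H geo) (≤-reflexive (sym (trans (size-standard p q e k) pq)))

  -- Comparison with the standard digraph without reversed arcs, which has `turán n` arcs, makes `G`
  -- tight.
  extremal⇒matchingReversed : (G : Digraph n) → Extremal2 G → MatchingReversedBipartite G
  extremal⇒matchingReversed G (geo , max) = balanced⇒matchingReversed 7≤n G geo₂ (tight⇒balanced 7≤n geo₂ tight)
    where
    geo₂ = geodetic⇒ G geo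
    tight : turán n ≤ arcs (arc G)
    tight = begin
      turán n                       ≡⟨ size-standard f c n≡f+c 0 ⟨
      size (standard f c n≡f+c 0)   ≤⟨ max _ (standard-geodetic f c n≡f+c 0) ⟩
      size G                        ≡⟨ size≡arcs G ⟩
      arcs (arc G)                  ∎
      where open ≤-Reasoning

  -- The value of `dir` decides whether the source part is the one of size `c` or of size `f`.
  matchingReversed⇒standard : (D : Digraph n) → MatchingReversedBipartite D →
    (∃ λ k → k ≤ f × (D ≅ standard c f n≡c+f k)) ⊎ (∃ λ k → k ≤ f × (D ≅ standard f c n≡f+c k))
  matchingReversed⇒standard D mrb = orient dir refl
    where
    open MatchingReversedBipartite mrb
    sizeX′ : sum (𝟙 ∘ part) ≡ c
    sizeX′ = trans (sym (count≡sum part)) sizeX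
    sizeY′ : sum (𝟙 ∘ not ∘ part) ≡ f
    sizeY′ = trans (sym (count≡sum (not ∘ part))) sizeY
    opposite : ∀ {u v} → part u ≢ part v → arc D u v ≡ not (arc D v u)
    opposite {u} {v} u≢v with across u v u≢v
    ... | inj₁ (uv , vu) rewrite uv | vu = refl
    ... | inj₂ (uv , vu) rewrite uv | vu = refl
    orient : ∀ d → dir ≡ d →
      (∃ λ k → k ≤ f × (D ≅ standard c f n≡c+f k)) ⊎ (∃ λ k → k ≤ f × (D ≅ standard f c n≡f+c k))
    orient true dir≡ with ≅-standard D part sizeX′ sizeY′ (inside _ _)
      (λ u∈ v∈ → opposite λ u≡v → true≢false (trans (sym u≡v) u∈) v∈)
      (λ u∈ u′∈ uv u′v′ → matching _ _ _ _ uv u′v′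
        (λ u≡ → true≢false (trans u≡ dir≡) u∈) (λ u≡ → true≢false (trans u≡ dir≡) u′∈)) n≡c+f
    ... | k , _ , k≤f , iso = inj₁ (k , k≤f , iso)
    orient false dir≡ with ≅-standard D (not ∘ part) sizeY′
      (trans (sum-cong-≗ (λ u → cong 𝟙 (Bool.not-involutive (part u)))) sizeX′)
      (λ u≡v → inside _ _ (Bool.not-injective u≡v))
      (λ u∈ v∈ → opposite λ u≡v → true≢false (trans (cong not (sym u≡v)) u∈) v∈)
      (λ u∈ u′∈ uv u′v′ → matching _ _ _ _ uv u′v′
        (λ u≡ → true≢false (cong not (trans u≡ dir≡)) u∈) (λ u≡ → true≢false (cong not (trans u≡ dir≡)) u′∈)) n≡f+c
    ... | k , k≤f , _ , iso = inj₂ (k , k≤f , iso)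

  -- {p , q} = {c , f}, so at most f arcs can be reversed.
  family : ∀ p q → n ≡ p + q → List (Digraph n)
  family p q e = applyUpTo (standard p q e) (suc f)

  family-extremal : ∀ p q e → p * q ≡ turán n → All Extremal2 (family p q e)
  family-extremal p q e pq = All.applyUpTo⁺₂ (standard p q e) (suc f) (standard-extremal p q e pq)

  family-distinct : ∀ p q e → 3 ≤ q → f ≤ p → f ≤ q → AllPairs (λ G H → ¬ (G ≅ H)) (family p q e)
  family-distinct p q e 3≤q f≤p f≤q = AllPairs.applyUpTo⁺₁ (standard p q e) (suc f) λ { i<j (s≤s j≤f) iso →
    let i≤f = ≤-trans (<⇒≤ i<j) j≤f in
    <⇒≢ i<j (standard-≅-reversed e 3≤q (≤-trans i≤f f≤p) (≤-trans i≤f f≤q) (≤-trans j≤f f≤p) (≤-trans j≤f f≤q) iso) }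

  family-complete : ∀ p q e (G : Digraph n) → (∃ λ k → k ≤ f × (G ≅ standard p q e k)) → Any (G ≅_) (family p q e)
  family-complete p q e G (k , k≤f , iso) = Any.applyUpTo⁺ (standard p q e) iso (s≤s k≤f)

  -- The numbers of sources `c` and `f` differ, so the two families are disjoint up to isomorphism,
  -- and `2 (f + 1) = n + 1`.
  odd-classes : c ≡ suc f → NumExtremalClasses n (n + 1)
  odd-classes c≡1+f = family c f n≡c+f ++ family f c n≡f+c
    , trans (List.length-++ (family c f n≡c+f))
        (trans (cong₂ _+_ (List.length-applyUpTo (standard c f n≡c+f) (suc f))
                          (List.length-applyUpTo (standard f c n≡f+c) (suc f))) length≡)
    , All.++⁺ (family-extremal c f n≡c+f (*-comm c f)) (family-extremal f c n≡f+c refl)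
    , AllPairs.++⁺ (family-distinct c f n≡c+f 3≤f f≤c ≤-refl) (family-distinct f c n≡f+c 3≤c ≤-refl f≤c)
        (All.applyUpTo⁺₂ (standard c f n≡c+f) (suc f) λ k →
          All.applyUpTo⁺₂ (standard f c n≡f+c) (suc f) λ k′ iso →
            1+n≢n (trans (sym c≡1+f) (standard-≅-sources {k = k} {k′} n≡c+f n≡f+c 3≤f 3≤c iso)))
    , λ G ext → [ Any.++⁺ˡ ∘ family-complete c f n≡c+f G
                , Any.++⁺ʳ (family c f n≡c+f) ∘ family-complete f c n≡f+c G ]′
                (matchingReversed⇒standard G (extremal⇒matchingReversed G ext))
    where
    length≡ : suc f + suc f ≡ n + 1
    length≡ = trans (cong (_+ suc f) (sym c≡1+f)) (trans (+-suc c f) (trans (cong suc (sym n≡c+f)) (+-comm 1 n)))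

  even-classes : c ≡ f → NumExtremalClasses n (f + 1)
  even-classes c≡f = family f c n≡f+c
    , trans (List.length-applyUpTo (standard f c n≡f+c) (suc f)) (+-comm 1 f)
    , family-extremal f c n≡f+c refl
    , family-distinct f c n≡f+c 3≤c ≤-refl f≤c
    , λ G ext → family-complete f c n≡f+c G ([ swap-parts {G = G} c≡f n≡c+f n≡f+c , id ]′
        (matchingReversed⇒standard G (extremal⇒matchingReversed G ext)))
    where
    swap-parts : ∀ {p q} {G : Digraph n} → p ≡ q → (e : n ≡ p + q) (e′ : n ≡ q + p) →
      (∃ λ k → k ≤ f × (G ≅ standard p q e k)) → ∃ λ k → k ≤ f × (G ≅ standard q p e′ k)
    -- Once `p` and `q` are identified, the two digraphs differ only in an irrelevant proof.
    swap-parts refl e e′ found = found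

-- Parity of the order and the classification.

n*2-halves : ∀ m → ⌊ m * 2 /2⌋ ≡ m × ⌈ m * 2 /2⌉ ≡ m
n*2-halves zero    = refl , refl
n*2-halves (suc m) with n*2-halves m
... | ⌊⌋≡ , ⌈⌉≡ = cong suc ⌊⌋≡ , cong suc ⌈⌉≡

odd-halves : ∀ n → n % 2 ≡ 1 → ⌈ n /2⌉ ≡ suc ⌊ n /2⌋
odd-halves n n%2≡1 = subst (λ k → ⌈ k /2⌉ ≡ suc ⌊ k /2⌋)
  (sym (trans (m≡m%n+[m/n]*n n 2) (cong (_+ n / 2 * 2) n%2≡1)))
  (cong suc (trans (proj₁ (n*2-halves (n / 2))) (sym (proj₂ (n*2-halves (n / 2))))))

even-halves : ∀ n → n % 2 ≡ 0 → ⌊ n /2⌋ ≡ n / 2 × ⌈ n /2⌉ ≡ n / 2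
even-halves n n%2≡0 = subst (λ k → ⌊ k /2⌋ ≡ n / 2 × ⌈ k /2⌉ ≡ n / 2)
  (sym (trans (m≡m%n+[m/n]*n n 2) (cong (_+ n / 2 * 2) n%2≡0))) (n*2-halves (n / 2))

theorem13 : (n : ℕ) → 7 ≤ n →
    ((G : Digraph n) → Extremal2 G →
    Σ (Digraph n) λ D → MatchingReversedBipartite D × (G ≅ D))
    × (n % 2 ≡ 1 → NumExtremalClasses n (n + 1))
    × (n % 2 ≡ 0 → NumExtremalClasses n (n / 2 + 1))
theorem13 n 7≤n =
    (λ G ext → G , extremal⇒matchingReversed 7≤n G ext , Perm.id , λ _ _ → refl)
  , (λ odd → odd-classes 7≤n (odd-halves n odd))
  , λ even → let ⌊⌋≡ , ⌈⌉≡ = even-halves n even in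
      subst (λ h → NumExtremalClasses n (h + 1)) ⌊⌋≡ (even-classes 7≤n (trans ⌈⌉≡ (sym ⌊⌋≡)))
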